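{- Let $(\mathbf{G},m,\Delta)$ be the twisted bialgebra of graphs. For any finite set $X$, any $\sim\in\mathcal{E}[X]$ and any graph $G\in\mathscr{G}[X]$, put \[\delta_\sim(G)=\begin{cases}G/\sim\otimes\,G\mid\sim&\text{if }\sim\in\mathcal{E}_c[G],\\0&\text{otherwise.}\end{cases}\] This defines a contraction-extraction coproduct $\delta$ on $\mathbf{G}$, and it is compatible with the product $m$ and the coproduct $\Delta$ (in the sense of the context).
   Context: $\mathbb{K}$ is a field. A graph is a pair $G=(V(G),E(G))$ with $V(G)$ a finite set and $E(G)$ a set of (unordered) pairs of distinct elements of $V(G)$. $\mathscr{G}[X]$ is the set of graphs with vertex set $X$, and $\mathbf{G}[X]$ the $\mathbb{K}$-vector space with basis $\mathscr{G}[X]$; bijections $\sigma:X\to Y$ act by relabelling vertices, making $\mathbf{G}$ a species (functor from finite sets with bijections to vector spaces). Product: $m_{X,Y}(G\otimes H)=GH$ is the disjoint union, with unit the empty graph $1\in\mathbf{G}[\emptyset]$. Coproduct: $\Delta_{X,Y}(G)=G_{\mid X}\otimes G_{\mid Y}$ for $G\in\mathscr{G}[X\sqcup Y]$, where $G_{\mid A}$ is the induced subgraph on $A$; the counit $\varepsilon_\Delta:\mathbf{G}[\emptyset]\to\mathbb{K}$ sends the empty graph to $1$. ($(\mathbf{G},m,\Delta)$ is a twisted bialgebra, i.e. a bialgebra in the category of species with the Cauchy tensor product.) $\mathcal{E}[X]$ is the set of equivalence relations on $X$, ordered by: $\sim\leq\sim'$ iff ($x\sim'y\Rightarrow x\sim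 y$). One identifies $\mathcal{E}[X/\sim']$ with $\{\sim\in\mathcal{E}[X]:\sim\leq\sim'\}$ and $(X/\sim')/\sim$ with $X/\sim$. For a bijection $\sigma:X\to Y$, $\sim_\sigma$ is the transported equivalence and $\sigma/\sim:X/\sim\to Y/\sim_\sigma$ the induced bijection. $\sim_X\sqcup\sim_Y$ is the equivalence on $X\sqcup Y$ whose classes are those of $\sim_X$ and those of $\sim_Y$. For $G\in\mathscr{G}[X]$ and $\sim\in\mathcal{E}[X]$: $G\mid\sim\,\in\mathscr{G}[X]$ has edges $\{x,y\}\in E(G)$ with $x\sim y$; $G/\sim\,\in\mathscr{G}[X/\sim]$ has as edges the pairs $\{\mathrm{cl}_\sim(x),\mathrm{cl}_\sim(y)\}$ with $\{x,y\}\in E(G)$ and $\mathrm{cl}_\sim(x)\neq\mathrm{cl}_\sim(y)$, where $\mathrm{cl}_\sim(x)$ is the class of $x$; $\sim\in\mathcal{E}_c[G]$ means that $G_{\mid C}$ is connected for every class $C$ of $\sim$. Contraction-extraction coproduct $\delta$ on a species $\mathbf{P}$: linear maps $\delta_\sim:\mathbf{P}[X]\to\mathbf{P}[X/\sim]\otimes\mathbf{P}[X]$ for every finite $X$ and $\sim\in\mathcal{E}[X]$, with: (i) $\delta_{\sim_\sigma}\circ\mathbf{P}[\sigma]=(\mathbf{P}[\sigma/\sim]\otimes\mathbf{P}[\sigma])\circ\delta_\sim$ for bijections $\sigma:X\to Y$; (ii) if $\sim\leq\sim'$, $(\delta_\sim\otimes\mathrm{Id})\circ\delta_{\sim'}=(\mathrm{Id}\otimes\delta_{\sim'})\circ\delta_\sim$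 (on the left $\delta_\sim$ is applied to $\mathbf{P}[X/\sim']$), and if $\sim\leq\sim'$ fails, $(\mathrm{Id}\otimes\delta_{\sim'})\circ\delta_\sim=0$; (iii) there are linear maps $\epsilon_\delta[X]:\mathbf{P}[X]\to\mathbb{K}$, invariant under bijections, such that $(\mathrm{Id}\otimes\epsilon_\delta[X])\circ\delta_\sim$ is $\mathrm{Id}$ if $\sim$ is the equality and $0$ otherwise, and $\sum_{\sim\in\mathcal{E}[X]}(\epsilon_\delta[X/\sim]\otimes\mathrm{Id})\circ\delta_\sim=\mathrm{Id}_{\mathbf{P}[X]}$. For a twisted bialgebra $(\mathbf{P},m,\Delta)$ with unit $1_{\mathbf{P}}$ and counit $\varepsilon_\Delta$, $\delta$ is compatible with $m$ and $\Delta$ if for all finite $X,Y$ and $\sim\in\mathcal{E}[X\sqcup Y]$, with $\sim_X=\sim\cap X^2$, $\sim_Y=\sim\cap Y^2$ and $c$ the flip: $\delta_\sim\circ m_{X,Y}$ equals $(m_{X/\sim_X,Y/\sim_Y}\otimes m_{X,Y})\circ(\mathrm{Id}\otimes c\otimes\mathrm{Id})\circ(\delta_{\sim_X}\otimes\delta_{\sim_Y})$ if $\sim=\sim_X\sqcup\sim_Y$ and $0$ otherwise; $(\Delta_{X/\sim_X,Y/\sim_Y}\otimes\mathrm{Id})\circ\delta_\sim=m_{1,3,24}\circ(\delta_{\sim_X}\otimes\delta_{\sim_Y})\circ\Delta_{X,Y}$ if $\sim=\sim_X\sqcup\sim_Y$, where $m_{1,3,24}(a\otimes b\otimes a'\otimes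 b')=a\otimes a'\otimes m_{X,Y}(b\otimes b')$; and, $\sim_\emptyset$ being the equivalence on $\emptyset$, $\delta_{\sim_\emptyset}(1_{\mathbf{P}})=1_{\mathbf{P}}\otimes1_{\mathbf{P}}$ and $(\varepsilon_\Delta\otimes\mathrm{Id})\circ\delta_{\sim_\emptyset}(x)=\varepsilon_\Delta(x)1_{\mathbf{P}}$ for $x\in\mathbf{P}[\emptyset]$. -}

module Defs where

open import Level using (Level; 0ℓ; _⊔_) renaming (suc to lsuc)
open import Data.Bool.Base using (if_then_else_)
open import Data.Empty using (⊥)
open import Data.List.Base using (List; []; _∷_; map; _++_; foldr; deduplicate; cartesianProductWith)
open import Data.List.Relation.Unary.Any using (Any; here; there; any?)
import Data.List.Relation.Unary.Any as Any
import Data.List.Relation.Unary.Any.Properties as Any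
open import Data.List.Relation.Unary.All using (all?)
import Data.List.Relation.Unary.All as All
open import Data.List.Relation.Unary.Enumerates.Setoid using (IsEnumeration)
open import Data.List.Relation.Unary.Unique.DecSetoid using (Unique)
open import Data.List.Relation.Unary.Unique.DecSetoid.Properties using (deduplicate-!)
open import Data.Product.Base using (Σ; ∃; _×_; _,_; proj₁; proj₂)
open import Data.Sum.Base using (_⊎_; inj₁; inj₂)
open import Data.Sum.Relation.Binary.Pointwise using (Pointwise; inj₁; inj₂; ⊎-decSetoid; ⊎-isDecEquivalence; ⊎-decidable; ⊎-symmetric; ⊎-irreflexive; ⊎-respects₂)
open import Function.Base using (id; _∘_; _on_)
open import Function.Bundles using (Func; Inverse)
import Function.Construct.Identity as Identity
import Function.Construct.Composition as Composition
open import Relation.Binary.Bundles using (Setoid; DecSetoid)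
open import Relation.Binary.Core using (Rel; _⇒_; _⇔_)
open import Relation.Binary.Definitions using (Decidable; Symmetric; Irreflexive; _Respects_; _Respects₂_)
import Relation.Binary.PropositionalEquality.Properties as ≡
open import Relation.Binary.PropositionalEquality.Core using (_≡_)
open import Relation.Binary.Structures using (IsEquivalence; IsDecEquivalence)
open import Relation.Nullary using (¬_; Dec; yes; no; does; contradiction)
open import Relation.Nullary.Decidable using (map′; _×-dec_; _⊎-dec_; _→-dec_; ¬?)
open import Relation.Unary as U using (Pred)
open import Algebra.Bundles using (CommutativeMonoid; CommutativeRing)
open import Algebra.Apartness.Bundles using (HeytingField; HeytingCommutativeRing)
open import Algebra.Module.Bundles using (LeftModule)
import Algebra.Module.Construct.TensorUnit as TensorUnit
open import Algebra.Module.Morphism.Structures using (IsLeftModuleHomomorphism)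
import Algebra.Module.Morphism.Construct.Identity as IdentityHom
import Algebra.Module.Morphism.Construct.Composition as CompositionHom
import Algebra.Properties.AbelianGroup as AbelianGroupProperties
import Algebra.Properties.CommutativeSemigroup as CommutativeSemigroupProperties
import Algebra.Module.Properties.LeftModule as LeftModuleProperties

------------------------------------------------------------------------
-- A finite set is a setoid with decidable equality and a list meeting
-- every class.  A quotient keeps the carrier and coarsens the equality.

record FiniteSet : Set₁ where
  field
    decSetoid : DecSetoid 0ℓ 0ℓ
  open DecSetoid decSetoid public
  field
    elements : List Carrier
    complete : IsEnumeration setoid elements

∣_∣ : FiniteSet → Set
∣_∣ = FiniteSet.Carrier

infix 4 _≃_ _⟶_

_≃_ : FiniteSet → FiniteSet → Set
X ≃ Y = Inverse (FiniteSet.setoid X) (FiniteSet.setoid Y)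

_⟶_ : FiniteSet → FiniteSet → Set
X ⟶ Y = Func (FiniteSet.setoid X) (FiniteSet.setoid Y)

≃-id : ∀ {X} → X ≃ X
≃-id {X} = Identity.inverse (FiniteSet.setoid X)

infixr 9 _≃∘_

_≃∘_ : ∀ {X Y Z} → Y ≃ Z → X ≃ Y → X ≃ Z
τ ≃∘ σ = Composition.inverse σ τ

inv⃗ : ∀ {X Y} → X ≃ Y → Y ⟶ X
inv⃗ σ = record { to = Inverse.from σ ; cong = Inverse.from-cong σ }

∅ : FiniteSet
∅ = record
  { decSetoid = record
    { Carrier = ⊥
    ; _≈_ = _≡_
    ; isDecEquivalence = record { isEquivalence = ≡.isEquivalence ; _≟_ = λ () }
    }
  ; elements = []
  ; complete = λ ()
  }

infixr 5 _⊍_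

_⊍_ : FiniteSet → FiniteSet → FiniteSet
X ⊍ Y = record
  { decSetoid = ⊎-decSetoid X.decSetoid Y.decSetoid
  ; elements  = map inj₁ X.elements ++ map inj₂ Y.elements
  ; complete  = λ
    { (inj₁ x) → Any.++⁺ˡ (Any.map⁺ (Any.map inj₁ (X.complete x)))
    ; (inj₂ y) → Any.++⁺ʳ (map inj₁ X.elements) (Any.map⁺ (Any.map inj₂ (Y.complete y)))
    }
  }
  where module X = FiniteSet X
        module Y = FiniteSet Y

ι₁ : ∀ {X Y} → X ⟶ X ⊍ Y
ι₁ = record { to = inj₁ ; cong = inj₁ }

ι₂ : ∀ {X Y} → Y ⟶ X ⊍ Y
ι₂ = record { to = inj₂ ; cong = inj₂ }

module _ (X : FiniteSet) where
  open FiniteSet X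

  ∃? : ∀ {p} {P : Pred Carrier p} → P Respects _≈_ → U.Decidable P → Dec (∃ P)
  ∃? resp P? = map′ Any.satisfied
    (λ (x , px) → Any.map (λ x≈e → resp x≈e px) (complete x)) (any? P? elements)

  ∀? : ∀ {p} {P : Pred Carrier p} → P Respects _≈_ → U.Decidable P → Dec (∀ x → P x)
  ∀? resp P? = map′
    (λ ps x → All.lookupWith (λ pe x≈e → resp (sym x≈e) pe) ps (complete x))
    (λ ps → All.universal ps elements) (all? P? elements)

module _ (X : FiniteSet) {P : Pred ∣ X ∣ 0ℓ} (P? : U.Decidable P) where
  open FiniteSet X

  private
    collect : List Carrier → List (Σ Carrier P)
    collect []       = []
    collect (x ∷ xs) with P? x
    ... | yes px = (x , px) ∷ collect xs
    ... | no  _  = collect xs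

    collect⁺ : ∀ {x} → P Respects _≈_ → P x → ∀ {xs} → Any (x ≈_) xs →
               Any (λ e → x ≈ proj₁ e) (collect xs)
    collect⁺ resp px {e ∷ xs} i with P? e
    collect⁺ resp px (here x≈e) | yes _  = here x≈e
    collect⁺ resp px (there i)  | yes _  = there (collect⁺ resp px i)
    collect⁺ resp px (here x≈e) | no ¬pe = contradiction (resp x≈e px) ¬pe
    collect⁺ resp px (there i)  | no _   = collect⁺ resp px i

  Subset : P Respects _≈_ → FiniteSet
  Subset resp = record
    { decSetoid = record
      { Carrier = Σ Carrier P
      ; _≈_ = _≈_ on proj₁
      ; isDecEquivalence = record
        { isEquivalence = record { refl = refl ; sym = sym ; trans = trans }
        ; _≟_ = λ x y → proj₁ x ≟ proj₁ y
        }
      }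
    ; elements = collect elements
    ; complete = λ (x , px) → collect⁺ resp px (complete x)
    }

------------------------------------------------------------------------

record 𝓔 (X : FiniteSet) : Set₁ where
  private module X = FiniteSet X
  infix 4 _∼_
  field
    _∼_              : Rel X.Carrier 0ℓ
    isDecEquivalence : IsDecEquivalence _∼_
    ≈⇒∼              : X._≈_ ⇒ _∼_
  open IsDecEquivalence isDecEquivalence public using (isEquivalence) renaming (refl to ∼-refl; sym to ∼-sym; trans to ∼-trans; _≟_ to _∼?_)

module _ {X : FiniteSet} where

  infix 4 _≈ᴱ_ _≤ᴱ_ _≤ᴱ?_

  _≈ᴱ_ : Rel (𝓔 X) 0ℓ
  r ≈ᴱ s = 𝓔._∼_ r ⇔ 𝓔._∼_ s

  _≤ᴱ_ : Rel (𝓔 X) 0ℓ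
  r ≤ᴱ s = 𝓔._∼_ s ⇒ 𝓔._∼_ r

  ≈ᴱ-isEquivalence : IsEquivalence _≈ᴱ_
  ≈ᴱ-isEquivalence = record
    { refl  = id , id
    ; sym   = λ (f , g) → g , f
    ; trans = λ (f , g) (h , k) → (λ z → h (f z)) , (λ z → g (k z))
    }

  _≤ᴱ?_ : Decidable _≤ᴱ_
  r ≤ᴱ? s = map′ (λ f {x} {y} → f x y) (λ f x y → f)
    (∀? X (λ x≈x′ f y x′sy → R.∼-trans (R.≈⇒∼ (sym x≈x′)) (f y (S.∼-trans (S.≈⇒∼ x≈x′) x′sy)))
      (λ x → ∀? X (λ y≈y′ f xsy′ → R.∼-trans (f (S.∼-trans xsy′ (S.≈⇒∼ (sym y≈y′)))) (R.≈⇒∼ y≈y′))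
        (λ y → (x S.∼? y) →-dec (x R.∼? y))))
    where open FiniteSet X
          module R = 𝓔 r
          module S = 𝓔 s

𝓔-decSetoid : FiniteSet → DecSetoid (lsuc 0ℓ) 0ℓ
𝓔-decSetoid X = record
  { Carrier = 𝓔 X
  ; _≈_ = _≈ᴱ_
  ; isDecEquivalence = record
    { isEquivalence = ≈ᴱ-isEquivalence
    ; _≟_ = λ r s → (s ≤ᴱ? r) ×-dec (r ≤ᴱ? s)
    }
  }

-- The list of all equivalence relations on X, each occurring once.
-- Candidates are the kernels of the functions obtained from the
-- identity by changing its values at the elements of X.
module _ (X : FiniteSet) where
  open FiniteSet X

  private
    kernel : X ⟶ X → 𝓔 X
    kernel f = record
      { _∼_ = λ x y → to x ≈ to y
      ; isDecEquivalence = record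
        { isEquivalence = record { refl = refl ; sym = sym ; trans = trans }
        ; _≟_ = λ x y → to x ≟ to y
        }
      ; ≈⇒∼ = cong
      }
      where open Func f using (to; cong)

    update : Carrier → Carrier → X ⟶ X → X ⟶ X
    update e a f = record { to = to′ ; cong = cong′ }
      where
      open Func f using (to; cong)
      to′ : Carrier → Carrier
      to′ x = if does (x ≟ e) then a else to x
      cong′ : ∀ {x y} → x ≈ y → to′ x ≈ to′ y
      cong′ {x} {y} x≈y with x ≟ e | y ≟ e
      ... | yes _   | yes _   = refl
      ... | yes x≈e | no  y≉e = contradiction (trans (sym x≈y) x≈e) y≉e
      ... | no  x≉e | yes y≈e = contradiction (trans x≈y y≈e) x≉e
      ... | no  _   | no  _   = cong x≈y

    functions : List Carrier → List (X ⟶ X)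
    functions []       = Identity.function setoid ∷ []
    functions (e ∷ es) = cartesianProductWith (update e) elements (functions es)

  equivalences : List (𝓔 X)
  equivalences = deduplicate (DecSetoid._≟_ (𝓔-decSetoid X)) (map kernel (functions elements))

  equivalences-unique : Unique (𝓔-decSetoid X) equivalences
  equivalences-unique = deduplicate-! (𝓔-decSetoid X) (map kernel (functions elements))

  private
    functions⁺ : (r : X ⟶ X) → ∀ es →
      Any (λ f → ∀ x → Any (x ≈_) es → Func.to f x ≈ Func.to r x) (functions es)
    functions⁺ r []       = here (λ _ ())
    functions⁺ r (e ∷ es) = Any.cartesianProductWith⁺ (update e) (λ {a} {f} → agree {a} {f})
      (complete (Func.to r e)) (functions⁺ r es)
      where
      agree : ∀ {a f} → Func.to r e ≈ a →
        (∀ x → Any (x ≈_) es → Func.to f x ≈ Func.to r x) →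
        ∀ x → Any (x ≈_) (e ∷ es) → Func.to (update e a f) x ≈ Func.to r x
      agree re≈a f≈r x i with x ≟ e | i
      ... | yes x≈e | _        = trans (sym re≈a) (Func.cong r (sym x≈e))
      ... | no  x≉e | here x≈e = contradiction x≈e x≉e
      ... | no  _   | there j  = f≈r x j

    module _ (s : 𝓔 X) where
      open 𝓔 s

      first : List Carrier → Carrier → Carrier
      first []       x = x
      first (e ∷ es) x = if does (e ∼? x) then e else first es x

      first-∼ : ∀ es x → first es x ∼ x
      first-∼ []       x = ∼-refl
      first-∼ (e ∷ es) x with e ∼? x
      ... | yes e∼x = e∼x
      ... | no  _   = first-∼ es x

      first-cong : ∀ {es x y} → x ∼ y → Any (x ≈_) es → first es x ≈ first es y
      first-cong {e ∷ es} {x} {y} x∼y i with e ∼? x | e ∼? y | i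
      ... | yes _   | yes _   | _        = refl
      ... | yes e∼x | no  e≁y | _        = contradiction (∼-trans e∼x x∼y) e≁y
      ... | no  e≁x | yes e∼y | _        = contradiction (∼-trans e∼y (∼-sym x∼y)) e≁x
      ... | no  e≁x | no  _   | here x≈e = contradiction (≈⇒∼ (sym x≈e)) e≁x
      ... | no  _   | no  _   | there j  = first-cong x∼y j

      representative : X ⟶ X
      representative = record
        { to = first elements
        ; cong = λ {x} x≈y → first-cong (≈⇒∼ x≈y) (complete x)
        }

      kernel-≈ᴱ : ∀ {f} → (∀ x → Any (x ≈_) elements → Func.to f x ≈ first elements x) →
                  s ≈ᴱ kernel f
      kernel-≈ᴱ f≈r =
          (λ {x} {y} x∼y → trans (f≈r x (complete x))
            (trans (first-cong x∼y (complete x)) (sym (f≈r y (complete y)))))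
        , (λ {x} {y} fx≈fy → ∼-trans (∼-sym (first-∼ elements x))
            (∼-trans (≈⇒∼ (trans (sym (f≈r x (complete x))) (trans fx≈fy (f≈r y (complete y)))))
              (first-∼ elements y)))

  equivalences-complete : IsEnumeration (DecSetoid.setoid (𝓔-decSetoid X)) equivalences
  equivalences-complete s = Any.deduplicate⁺ (DecSetoid._≟_ (𝓔-decSetoid X))
    (λ {r} {t} t≈r s≈r → DecSetoid.trans (𝓔-decSetoid X) {s} {r} {t} s≈r (proj₂ t≈r , proj₁ t≈r))
    (Any.map⁺ (Any.map (λ {f} → kernel-≈ᴱ s {f}) (functions⁺ (representative s) elements)))

-- The equality of X, the largest element for _≤ᴱ_.
discrete : ∀ X → 𝓔 X
discrete X = record
  { _∼_ = _≈_ ; isDecEquivalence = isDecEquivalence ; ≈⇒∼ = id }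
  where open FiniteSet X

infixl 7 _↾ᴱ_

-- Inverse image of an equivalence: its restriction if f is an
-- inclusion, its transport along σ if f is the inverse of σ.
_↾ᴱ_ : ∀ {X Y} → 𝓔 X → Y ⟶ X → 𝓔 Y
s ↾ᴱ f = record
  { _∼_ = _∼_ on to
  ; isDecEquivalence = record
    { isEquivalence = record { refl = ∼-refl ; sym = ∼-sym ; trans = ∼-trans }
    ; _≟_ = λ x y → to x ∼? to y
    }
  ; ≈⇒∼ = ≈⇒∼ ∘ cong
  }
  where open 𝓔 s
        open Func f using (to; cong)

transport : ∀ {X Y} → X ≃ Y → 𝓔 X → 𝓔 Y
transport {X} {Y} σ s = s ↾ᴱ inv⃗ {X} {Y} σ

infixl 7 _∣₁ _∣₂

_∣₁ : ∀ {X Y} → 𝓔 (X ⊍ Y) → 𝓔 X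
_∣₁ {X} {Y} s = s ↾ᴱ ι₁ {X} {Y}

_∣₂ : ∀ {X Y} → 𝓔 (X ⊍ Y) → 𝓔 Y
_∣₂ {X} {Y} s = s ↾ᴱ ι₂ {X} {Y}

infixr 5 _⊍ᴱ_

_⊍ᴱ_ : ∀ {X Y} → 𝓔 X → 𝓔 Y → 𝓔 (X ⊍ Y)
r ⊍ᴱ s = record
  { _∼_ = Pointwise R._∼_ S._∼_
  ; isDecEquivalence = ⊎-isDecEquivalence R.isDecEquivalence S.isDecEquivalence
  ; ≈⇒∼ = λ { (inj₁ p) → inj₁ (R.≈⇒∼ p) ; (inj₂ p) → inj₂ (S.≈⇒∼ p) }
  }
  where module R = 𝓔 r
        module S = 𝓔 s

Splits : ∀ {X Y} → 𝓔 (X ⊍ Y) → Set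
Splits s = s ≈ᴱ (s ∣₁) ⊍ᴱ (s ∣₂)

infixl 6 _/_

_/_ : (X : FiniteSet) → 𝓔 X → FiniteSet
X / s = record
  { decSetoid = record { isDecEquivalence = isDecEquivalence }
  ; elements  = elements
  ; complete  = λ x → Any.map ≈⇒∼ (complete x)
  }
  where open FiniteSet X hiding (isDecEquivalence)
        open 𝓔 s

-- The equivalence on X / s corresponding to r ≤ s.
_over_ : ∀ {X} (r : 𝓔 X) {s : 𝓔 X} → r ≤ᴱ s → 𝓔 (X / s)
r over r≤s = record { _∼_ = _∼_ ; isDecEquivalence = isDecEquivalence ; ≈⇒∼ = r≤s }
  where open 𝓔 r

-- The identifications between quotients are all the identity on
-- carriers.

/-cong : ∀ {X} {r s : 𝓔 X} → r ≈ᴱ s → X / r ≃ X / s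
/-cong (r⇒s , s⇒r) = record
  { to = id ; from = id ; to-cong = r⇒s ; from-cong = s⇒r ; inverse = r⇒s , s⇒r }

/-map : ∀ {X Y} (σ : X ≃ Y) (s : 𝓔 X) → X / s ≃ Y / transport σ s
/-map {X} {Y} σ s = record
  { to        = to
  ; from      = from
  ; to-cong   = λ {x} {y} x∼y → ∼-trans (≈⇒∼ (inverseʳ Y.refl)) (∼-trans x∼y (≈⇒∼ (X.sym (inverseʳ Y.refl))))
  ; from-cong = id
  ; inverse   = (λ y∼fx → ∼-trans (≈⇒∼ (inverseʳ Y.refl)) y∼fx)
              , (λ y∼tx → ∼-trans y∼tx (≈⇒∼ (inverseʳ Y.refl)))
  }
  where open Inverse σ
        open 𝓔 s
        module X = FiniteSet X
        module Y = FiniteSet Y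

/-/ : ∀ {X} {r s : 𝓔 X} (r≤s : r ≤ᴱ s) → (X / s) / (r over r≤s) ≃ X / r
/-/ _ = record
  { to = id ; from = id ; to-cong = id ; from-cong = id ; inverse = id , id }

/-discrete : ∀ {X} {s : 𝓔 X} → s ≈ᴱ discrete X → X / s ≃ X
/-discrete (s⇒≈ , ≈⇒s) = record
  { to = id ; from = id ; to-cong = s⇒≈ ; from-cong = ≈⇒s ; inverse = s⇒≈ , ≈⇒s }

∅/discrete : ∅ / discrete ∅ ≃ ∅
∅/discrete = /-discrete {∅} {discrete ∅} (id , id)

/-⊍ : ∀ {X Y} (s : 𝓔 (X ⊍ Y)) → Splits s → (X ⊍ Y) / s ≃ (X / (s ∣₁)) ⊍ (Y / (s ∣₂))
/-⊍ s (s⇒⊍ , ⊍⇒s) = record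
  { to = id ; from = id ; to-cong = s⇒⊍ ; from-cong = ⊍⇒s ; inverse = s⇒⊍ , ⊍⇒s }

Class : ∀ {X} → 𝓔 X → ∣ X ∣ → FiniteSet
Class {X} s x = Subset X (x ∼?_) (λ y≈z x∼y → ∼-trans x∼y (≈⇒∼ y≈z))
  where open 𝓔 s

class⃗ : ∀ {X} (s : 𝓔 X) (x : ∣ X ∣) → Class s x ⟶ X
class⃗ s x = record { to = proj₁ ; cong = id }

------------------------------------------------------------------------

-- An unordered pair {x , y} of distinct elements is an edge iff Adj x y.
record Graph (X : FiniteSet) : Set₁ where
  open FiniteSet X using (Carrier; _≈_)
  field
    Adj        : Rel Carrier 0ℓ
    adj?       : Decidable Adj
    adj-resp   : Adj Respects₂ _≈_
    adj-sym    : Symmetric Adj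
    adj-irrefl : Irreflexive _≈_ Adj

module _ {X : FiniteSet} where

  infix 4 _≈ᴳ_

  _≈ᴳ_ : Rel (Graph X) 0ℓ
  G ≈ᴳ H = Graph.Adj G ⇔ Graph.Adj H

  ≈ᴳ-isEquivalence : IsEquivalence _≈ᴳ_
  ≈ᴳ-isEquivalence = record
    { refl  = id , id
    ; sym   = λ (f , g) → g , f
    ; trans = λ (f , g) (h , k) → (λ z → h (f z)) , (λ z → g (k z))
    }

𝓖 : FiniteSet → Setoid (lsuc 0ℓ) 0ℓ
𝓖 X = record { isEquivalence = ≈ᴳ-isEquivalence {X} }

infixl 7 _↾_

-- Inverse image of a graph: the induced subgraph if f is an inclusion,
-- the relabelling by σ if f is the inverse of σ.
_↾_ : ∀ {X Y} → Graph X → Y ⟶ X → Graph Y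
G ↾ f = record
  { Adj        = Adj on to
  ; adj?       = λ x y → adj? (to x) (to y)
  ; adj-resp   = (λ p → proj₁ adj-resp (cong p)) , (λ p → proj₂ adj-resp (cong p))
  ; adj-sym    = adj-sym
  ; adj-irrefl = adj-irrefl ∘ cong
  }
  where open Graph G
        open Func f using (to; cong)

relabel : ∀ {X Y} → X ≃ Y → Graph X → Graph Y
relabel {X} {Y} σ G = G ↾ inv⃗ {X} {Y} σ

emptyGraph : Graph ∅
emptyGraph = record
  { Adj        = λ _ _ → ⊥
  ; adj?       = λ ()
  ; adj-resp   = (λ _ ()) , (λ _ ())
  ; adj-sym    = λ ()
  ; adj-irrefl = λ _ ()
  }

infixr 5 _⊍ᴳ_

_⊍ᴳ_ : ∀ {X Y} → Graph X → Graph Y → Graph (X ⊍ Y)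
G ⊍ᴳ H = record
  { Adj        = Pointwise G.Adj H.Adj
  ; adj?       = ⊎-decidable G.adj? H.adj?
  ; adj-resp   = ⊎-respects₂ G.adj-resp H.adj-resp
  ; adj-sym    = ⊎-symmetric G.adj-sym H.adj-sym
  ; adj-irrefl = ⊎-irreflexive G.adj-irrefl H.adj-irrefl
  }
  where module G = Graph G
        module H = Graph H

infixl 7 _∣ᴳ_ _/ᴳ_

_∣ᴳ_ : ∀ {X} → Graph X → 𝓔 X → Graph X
_∣ᴳ_ {X} G s = record
  { Adj        = λ x y → Adj x y × x ∼ y
  ; adj?       = λ x y → adj? x y ×-dec x ∼? y
  ; adj-resp   = (λ p (a , q) → proj₁ adj-resp p a , ∼-trans q (≈⇒∼ p))
               , (λ p (a , q) → proj₂ adj-resp p a , ∼-trans (≈⇒∼ (FiniteSet.sym X p)) q)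
  ; adj-sym    = λ (a , q) → adj-sym a , ∼-sym q
  ; adj-irrefl = λ p (a , _) → adj-irrefl p a
  }
  where open Graph G
        open 𝓔 s

_/ᴳ_ : ∀ {X} → Graph X → (s : 𝓔 X) → Graph (X / s)
_/ᴳ_ {X} G s = record
  { Adj        = λ x y → ¬ x ∼ y × (∃ λ x′ → ∃ λ y′ → x ∼ x′ × y ∼ y′ × Adj x′ y′)
  ; adj?       = λ x y → ¬? (x ∼? y) ×-dec
      ∃? X (λ p (y′ , q , q′ , a) → y′ , ∼-trans q (≈⇒∼ p) , q′ , proj₂ adj-resp p a)
        (λ x′ → ∃? X (λ p (q , q′ , a) → q , ∼-trans q′ (≈⇒∼ p) , proj₁ adj-resp p a)
          (λ y′ → x ∼? x′ ×-dec y ∼? y′ ×-dec adj? x′ y′))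
  ; adj-resp   = (λ p (n , x′ , y′ , q , q′ , a) →
                   (λ r → n (∼-trans r (∼-sym p))) , x′ , y′ , q , ∼-trans (∼-sym p) q′ , a)
               , (λ p (n , x′ , y′ , q , q′ , a) →
                   (λ r → n (∼-trans p r)) , x′ , y′ , ∼-trans (∼-sym p) q , q′ , a)
  ; adj-sym    = λ (n , x′ , y′ , q , q′ , a) → n ∘ ∼-sym , y′ , x′ , q′ , q , adj-sym a
  ; adj-irrefl = λ p (n , _) → n p
  }
  where open Graph G
        open 𝓔 s

------------------------------------------------------------------------

data Walk {X : FiniteSet} (G : Graph X) : Rel ∣ X ∣ 0ℓ where
  stop : ∀ {x y} → FiniteSet._≈_ X x y → Walk G x y
  step : ∀ {x y z} → Graph.Adj G x y → Walk G y z → Walk G x z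

-- The empty graph counts as connected; this is only used for graphs on
-- equivalence classes, which are nonempty.
Connected : ∀ {X} → Graph X → Set
Connected G = ∀ x y → Walk G x y

infix 4 _∈𝓔c_

_∈𝓔c_ : ∀ {X} → 𝓔 X → Graph X → Set
s ∈𝓔c G = ∀ x → Connected {Class s x} (G ↾ class⃗ s x)

module _ {X : FiniteSet} (G : Graph X) where
  open FiniteSet X
  open Graph G

  infixr 5 _++ʷ_
  _++ʷ_ : ∀ {x y z} → Walk G x y → Walk G y z → Walk G x z
  stop x≈y ++ʷ stop y≈z   = stop (trans x≈y y≈z)
  stop x≈y ++ʷ step a w   = step (proj₂ adj-resp (sym x≈y) a) w
  step a v ++ʷ w          = step a (v ++ʷ w)

  private
    -- Walks all of whose inner vertices lie in the list.
    Reach : List Carrier → Rel Carrier 0ℓ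
    Reach []       x y = x ≈ y ⊎ Adj x y
    Reach (v ∷ vs) x y = Reach vs x y ⊎ (Reach vs x v × Reach vs v y)

    reach? : ∀ vs → Decidable (Reach vs)
    reach? []       x y = x ≟ y ⊎-dec adj? x y
    reach? (v ∷ vs) x y = reach? vs x y ⊎-dec (reach? vs x v ×-dec reach? vs v y)

    reach⇒walk : ∀ vs {x y} → Reach vs x y → Walk G x y
    reach⇒walk []       (inj₁ p)       = stop p
    reach⇒walk []       (inj₂ a)       = step a (stop refl)
    reach⇒walk (v ∷ vs) (inj₁ r)       = reach⇒walk vs r
    reach⇒walk (v ∷ vs) (inj₂ (r , s)) = reach⇒walk vs r ++ʷ reach⇒walk vs s

    base : ∀ vs {x y} → x ≈ y ⊎ Adj x y → Reach vs x y
    base []       b = b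
    base (v ∷ vs) b = inj₁ (base vs b)

    reach-respʳ : ∀ vs {x y z} → y ≈ z → Reach vs x y → Reach vs x z
    reach-respʳ []       p (inj₁ q)       = inj₁ (trans q p)
    reach-respʳ []       p (inj₂ a)       = inj₂ (proj₁ adj-resp p a)
    reach-respʳ (v ∷ vs) p (inj₁ r)       = inj₁ (reach-respʳ vs p r)
    reach-respʳ (v ∷ vs) p (inj₂ (r , s)) = inj₂ (r , reach-respʳ vs p s)

    reach-respˡ : ∀ vs {x y z} → x ≈ z → Reach vs x y → Reach vs z y
    reach-respˡ []       p (inj₁ q)       = inj₁ (trans (sym p) q)
    reach-respˡ []       p (inj₂ a)       = inj₂ (proj₂ adj-resp p a)
    reach-respˡ (v ∷ vs) p (inj₁ r)       = inj₁ (reach-respˡ vs p r)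
    reach-respˡ (v ∷ vs) p (inj₂ (r , s)) = inj₂ (reach-respˡ vs p r , s)

    through : ∀ {vs x v y} → Any (v ≈_) vs → Reach vs x v → Reach vs v y → Reach vs x y
    through {w ∷ ws} (here v≈w) r s = inj₂ (left r , right s)
      where
      left : ∀ {x} → Reach (w ∷ ws) x _ → Reach ws x w
      left (inj₁ r)       = reach-respʳ ws v≈w r
      left (inj₂ (r , _)) = r
      right : ∀ {y} → Reach (w ∷ ws) _ y → Reach ws w y
      right (inj₁ s)       = reach-respˡ ws v≈w s
      right (inj₂ (_ , s)) = s
    through (there i) (inj₁ r)       (inj₁ s)       = inj₁ (through i r s)
    through (there i) (inj₁ r)       (inj₂ (s , t)) = inj₂ (through i r s , t)
    through (there i) (inj₂ (r , s)) (inj₁ t)       = inj₂ (r , through i s t)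
    through (there i) (inj₂ (r , _)) (inj₂ (_ , t)) = inj₂ (r , t)

    walk⇒reach : ∀ {x y} → Walk G x y → Reach elements x y
    walk⇒reach (stop p)           = base elements (inj₁ p)
    walk⇒reach (step {y = y} a w) = through (complete y) (base elements (inj₂ a)) (walk⇒reach w)

    walk? : Decidable (Walk G)
    walk? x y = map′ (reach⇒walk elements) walk⇒reach (reach? elements x y)

  connected? : Dec (Connected G)
  connected? = ∀? X (λ x≈z c y → stop (sym x≈z) ++ʷ c y)
    (λ x → ∀? X (λ y≈z w → w ++ʷ stop y≈z) (walk? x))

Walk-map : ∀ {X Y} {G : Graph X} {H : Graph Y} (f : X ⟶ Y) →
           (∀ {x y} → Graph.Adj G x y → Graph.Adj H (Func.to f x) (Func.to f y)) →
           ∀ {x y} → Walk G x y → Walk H (Func.to f x) (Func.to f y)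
Walk-map f h (stop p)   = stop (Func.cong f p)
Walk-map f h (step a w) = step (h a) (Walk-map f h w)

𝓔c-cong : ∀ {X} (s : 𝓔 X) {G H : Graph X} → G ≈ᴳ H → s ∈𝓔c G → s ∈𝓔c H
𝓔c-cong s G≈H c x y z = Walk-map (Identity.function _) (proj₁ G≈H) (c x y z)

opaque
  ∈𝓔c? : ∀ {X} (s : 𝓔 X) (G : Graph X) → Dec (s ∈𝓔c G)
  ∈𝓔c? {X} s G = ∀? X
    (λ {x} {z} x≈z c u v →
      let w = Walk-map (shift (≈⇒∼ x≈z)) id (c (back (≈⇒∼ x≈z) u) (back (≈⇒∼ x≈z) v))
          H = G ↾ class⃗ s z
      in _++ʷ_ H {x = u} (stop (FiniteSet.refl X)) (_++ʷ_ H {z = v} w (stop (FiniteSet.refl X))))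
    (λ x → connected? (G ↾ class⃗ s x))
    where
    open 𝓔 s
    shift : ∀ {x z} → x ∼ z → Class s x ⟶ Class s z
    shift x∼z = record { to = λ (u , x∼u) → u , ∼-trans (∼-sym x∼z) x∼u ; cong = id }
    back : ∀ {x z} → x ∼ z → ∣ Class s z ∣ → ∣ Class s x ∣
    back x∼z (u , z∼u) = u , ∼-trans x∼z z∼u

------------------------------------------------------------------------
-- Classically, a Heyting field is a field, with # as inequality.

module OverField {c ℓ₁ ℓ₂ : Level} (K : HeytingField c ℓ₁ ℓ₂) where

  𝕂 : CommutativeRing c ℓ₁
  𝕂 = HeytingCommutativeRing.commutativeRing (HeytingField.heytingCommutativeRing K)

  private
    module 𝕂 = CommutativeRing 𝕂
    open 𝕂 using (0#; 1#) renaming (Carrier to Scalar; _+_ to _+ˢ_; _*_ to _*ˢ_; _≈_ to _≈ˢ_)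

  VectorSpace : (m ℓm : Level) → Set (c ⊔ ℓ₁ ⊔ lsuc (m ⊔ ℓm))
  VectorSpace = LeftModule 𝕂.ring

  private
    variable
      m ℓm n ℓn p ℓp q ℓq : Level

  open LeftModule using (Carrierᴹ; rawLeftModule)

  infixr 1 _⊸_

  record _⊸_ (M : VectorSpace m ℓm) (N : VectorSpace n ℓn) : Set (c ⊔ m ⊔ ℓm ⊔ n ⊔ ℓn) where
    field
      ⟦_⟧ : Carrierᴹ M → Carrierᴹ N
      isLeftModuleHomomorphism : IsLeftModuleHomomorphism (rawLeftModule M) (rawLeftModule N) ⟦_⟧
    open IsLeftModuleHomomorphism isLeftModuleHomomorphism public
      using (⟦⟧-cong; +ᴹ-homo; *ₗ-homo; 0ᴹ-homo; -ᴹ-homo)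

  open _⊸_ public using (⟦_⟧)

  infix 0 _≐_

  record _≐_ {M : VectorSpace m ℓm} {N : VectorSpace n ℓn} (f g : M ⊸ N) : Set (m ⊔ ℓn) where
    constructor pointwise
    field
      at : (x : Carrierᴹ M) → LeftModule._≈ᴹ_ N (⟦ f ⟧ x) (⟦ g ⟧ x)

  open _≐_ public using (at)

  -- Zero and negatives are preserved automatically.
  linear : {M : VectorSpace m ℓm} {N : VectorSpace n ℓn} →
           let module M = LeftModule M
               module N = LeftModule N in
           (f : M.Carrierᴹ → N.Carrierᴹ) →
           (∀ {x y} → x M.≈ᴹ y → f x N.≈ᴹ f y) →
           (∀ x y → f (x M.+ᴹ y) N.≈ᴹ f x N.+ᴹ f y) →
           (∀ k x → f (k M.*ₗ x) N.≈ᴹ k N.*ₗ f x) →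
           M ⊸ N
  linear {M = M} {N} f f-cong f-+ f-* = record
    { ⟦_⟧ = f
    ; isLeftModuleHomomorphism = record
      { +ᴹ-isGroupHomomorphism = record
        { isMonoidHomomorphism = record
          { isMagmaHomomorphism = record
            { isRelHomomorphism = record { cong = f-cong }
            ; homo = f-+
            }
          ; ε-homo = f-0
          }
        ; ⁻¹-homo = λ x → inverseˡ-uniqueᴹ (f (M.-ᴹ x)) (f x)
            (N.≈ᴹ-trans (N.≈ᴹ-sym (f-+ (M.-ᴹ x) x))
              (N.≈ᴹ-trans (f-cong (M.-ᴹ‿inverseˡ x)) f-0))
        }
      ; *ₗ-homo = f-*
      }
    }
    where
    module M = LeftModule M
    module N = LeftModule N
    open LeftModuleProperties N using (inverseˡ-uniqueᴹ)
    f-0 : f M.0ᴹ N.≈ᴹ N.0ᴹ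
    f-0 = N.≈ᴹ-trans (f-cong (M.≈ᴹ-sym (M.*ₗ-zeroˡ M.0ᴹ)))
            (N.≈ᴹ-trans (f-* 0# M.0ᴹ) (N.*ₗ-zeroˡ (f M.0ᴹ)))

  idₗ : {M : VectorSpace m ℓm} → M ⊸ M
  idₗ {M = M} = record
    { ⟦_⟧ = id
    ; isLeftModuleHomomorphism = IdentityHom.isLeftModuleHomomorphism (rawLeftModule M) (LeftModule.≈ᴹ-refl M)
    }

  infixr 9 _∘ₗ_

  _∘ₗ_ : {M : VectorSpace m ℓm} {N : VectorSpace n ℓn} {P : VectorSpace p ℓp} →
         N ⊸ P → M ⊸ N → M ⊸ P
  _∘ₗ_ {P = P} g f = record
    { ⟦_⟧ = λ x → ⟦ g ⟧ (⟦ f ⟧ x)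
    ; isLeftModuleHomomorphism = CompositionHom.isLeftModuleHomomorphism
        (LeftModule.≈ᴹ-trans P) (_⊸_.isLeftModuleHomomorphism f) (_⊸_.isLeftModuleHomomorphism g)
    }

  Hom : VectorSpace m ℓm → VectorSpace n ℓn → VectorSpace (c ⊔ m ⊔ ℓm ⊔ n ⊔ ℓn) (m ⊔ ℓn)
  Hom M N = record
    { Carrierᴹ = M ⊸ N
    ; _≈ᴹ_ = _≐_
    ; _+ᴹ_ = λ f g → linear (λ x → ⟦ f ⟧ x N.+ᴹ ⟦ g ⟧ x)
        (λ x≈y → N.+ᴹ-cong (⟦⟧-cong f x≈y) (⟦⟧-cong g x≈y))
        (λ x y → N.≈ᴹ-trans (N.+ᴹ-cong (+ᴹ-homo f x y) (+ᴹ-homo g x y)) (+-interchange _ _ _ _))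
        (λ k x → N.≈ᴹ-trans (N.+ᴹ-cong (*ₗ-homo f k x) (*ₗ-homo g k x)) (N.≈ᴹ-sym (N.*ₗ-distribˡ k _ _)))
    ; _*ₗ_ = scale
    ; 0ᴹ = linear (λ _ → N.0ᴹ) (λ _ → N.≈ᴹ-refl)
        (λ _ _ → N.≈ᴹ-sym (N.+ᴹ-identityˡ N.0ᴹ))
        (λ k _ → N.≈ᴹ-sym (N.*ₗ-zeroʳ k))
    ; -ᴹ_ = λ f → linear (λ x → N.-ᴹ ⟦ f ⟧ x)
        (λ x≈y → N.-ᴹ‿cong (⟦⟧-cong f x≈y))
        (λ x y → N.≈ᴹ-trans (N.-ᴹ‿cong (+ᴹ-homo f x y)) (N.≈ᴹ-sym (⁻¹-∙-comm _ _)))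
        (λ k x → N.≈ᴹ-trans (N.-ᴹ‿cong (*ₗ-homo f k x)) (neg-scale k (⟦ f ⟧ x)))
    ; isLeftModule = record
      { isLeftSemimodule = record
        { +ᴹ-isCommutativeMonoid = record
          { isMonoid = record
            { isSemigroup = record
              { isMagma = record
                { isEquivalence = record
                  { refl  = pointwise λ _ → N.≈ᴹ-refl
                  ; sym   = λ e → pointwise λ x → N.≈ᴹ-sym (at e x)
                  ; trans = λ e e′ → pointwise λ x → N.≈ᴹ-trans (at e x) (at e′ x)
                  }
                ; ∙-cong = λ e e′ → pointwise λ x → N.+ᴹ-cong (at e x) (at e′ x)
                }
              ; assoc = λ f g h → pointwise λ x → N.+ᴹ-assoc _ _ _
              }
            ; identity = (λ f → pointwise λ x → N.+ᴹ-identityˡ _) , (λ f → pointwise λ x → N.+ᴹ-identityʳ _)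
            }
          ; comm = λ f g → pointwise λ x → N.+ᴹ-comm _ _
          }
        ; isPreleftSemimodule = record
          { *ₗ-cong      = λ k≈l e → pointwise λ x → N.*ₗ-cong k≈l (at e x)
          ; *ₗ-zeroˡ     = λ f → pointwise λ x → N.*ₗ-zeroˡ _
          ; *ₗ-distribʳ  = λ f k l → pointwise λ x → N.*ₗ-distribʳ _ k l
          ; *ₗ-identityˡ = λ f → pointwise λ x → N.*ₗ-identityˡ _
          ; *ₗ-assoc     = λ k l f → pointwise λ x → N.*ₗ-assoc k l _
          ; *ₗ-zeroʳ     = λ k → pointwise λ x → N.*ₗ-zeroʳ k
          ; *ₗ-distribˡ  = λ k f g → pointwise λ x → N.*ₗ-distribˡ k _ _
          }
        }
      ; -ᴹ‿cong = λ e → pointwise λ x → N.-ᴹ‿cong (at e x)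
      ; -ᴹ‿inverse = (λ f → pointwise λ x → N.-ᴹ‿inverseˡ _) , (λ f → pointwise λ x → N.-ᴹ‿inverseʳ _)
      }
    }
    where
    module N = LeftModule N
    open _⊸_ using (⟦⟧-cong; +ᴹ-homo; *ₗ-homo)
    open AbelianGroupProperties N.+ᴹ-abelianGroup using (⁻¹-∙-comm)
    open CommutativeSemigroupProperties (CommutativeMonoid.commutativeSemigroup N.+ᴹ-commutativeMonoid)
      using () renaming (interchange to +-interchange)
    open LeftModuleProperties N using (inverseˡ-uniqueᴹ)
    scale : Scalar → M ⊸ N → M ⊸ N
    scale k f = linear (λ x → k N.*ₗ ⟦ f ⟧ x)
      (λ x≈y → N.*ₗ-cong 𝕂.refl (⟦⟧-cong f x≈y))
      (λ x y → N.≈ᴹ-trans (N.*ₗ-cong 𝕂.refl (+ᴹ-homo f x y)) (N.*ₗ-distribˡ k _ _))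
      (λ l x → N.≈ᴹ-trans (N.*ₗ-cong 𝕂.refl (*ₗ-homo f l x))
        (N.≈ᴹ-trans (N.≈ᴹ-sym (N.*ₗ-assoc k l _))
          (N.≈ᴹ-trans (N.*ₗ-cong (𝕂.*-comm k l) N.≈ᴹ-refl) (N.*ₗ-assoc l k _))))
    neg-scale : ∀ k y → N.-ᴹ (k N.*ₗ y) N.≈ᴹ k N.*ₗ (N.-ᴹ y)
    neg-scale k y = N.≈ᴹ-sym (inverseˡ-uniqueᴹ _ _
      (N.≈ᴹ-trans (N.≈ᴹ-sym (N.*ₗ-distribˡ k _ _))
        (N.≈ᴹ-trans (N.*ₗ-cong 𝕂.refl (N.-ᴹ‿inverseˡ y)) (N.*ₗ-zeroʳ k))))

  0ₗ : {M : VectorSpace m ℓm} {N : VectorSpace n ℓn} → M ⊸ N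
  0ₗ {M = M} {N} = LeftModule.0ᴹ (Hom M N)

  sumₗ : {M : VectorSpace m ℓm} {N : VectorSpace n ℓn} → List (M ⊸ N) → M ⊸ N
  sumₗ {M = M} {N} = foldr _+ᴹ_ 0ᴹ
    where open LeftModule (Hom M N)

  𝕂ᴹ : VectorSpace c ℓ₁
  𝕂ᴹ = TensorUnit.leftModule {R = 𝕂.ring}

  ----------------------------------------------------------------------

  infixl 6 _⊕_
  infixr 7 _·_

  data Term {b : Level} (B : Set b) : Set (c ⊔ b) where
    gen : B → Term B
    𝟘   : Term B
    _⊕_ : Term B → Term B → Term B
    _·_ : Scalar → Term B → Term B

  module _ {b r : Level} {B : Set b} (R : Rel (Term B) r) where

    -- The least congruence containing R and satisfying the axioms of a
    -- vector space, with (- 1#) · t as negative of t.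
    data Congruence : Rel (Term B) (c ⊔ ℓ₁ ⊔ b ⊔ r) where
      rel        : ∀ {s t} → R s t → Congruence s t
      ≈-refl     : ∀ {s} → Congruence s s
      ≈-sym      : ∀ {s t} → Congruence s t → Congruence t s
      ≈-trans    : ∀ {s t u} → Congruence s t → Congruence t u → Congruence s u
      ⊕-cong     : ∀ {s s′ t t′} → Congruence s s′ → Congruence t t′ → Congruence (s ⊕ t) (s′ ⊕ t′)
      ·-cong     : ∀ {k k′ t t′} → k ≈ˢ k′ → Congruence t t′ → Congruence (k · t) (k′ · t′)
      ⊕-assoc    : ∀ s t u → Congruence ((s ⊕ t) ⊕ u) (s ⊕ (t ⊕ u))
      ⊕-comm     : ∀ s t → Congruence (s ⊕ t) (t ⊕ s)
      ⊕-identity : ∀ t → Congruence (𝟘 ⊕ t) t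
      ·-distribˡ : ∀ k s t → Congruence (k · (s ⊕ t)) (k · s ⊕ k · t)
      ·-distribʳ : ∀ t k l → Congruence ((k +ˢ l) · t) (k · t ⊕ l · t)
      ·-assoc    : ∀ k l t → Congruence ((k *ˢ l) · t) (k · l · t)
      ·-identity : ∀ t → Congruence (1# · t) t
      ·-zero     : ∀ t → Congruence (0# · t) 𝟘

    Presented : VectorSpace (c ⊔ b) (c ⊔ ℓ₁ ⊔ b ⊔ r)
    Presented = record
      { Carrierᴹ = Term B
      ; _≈ᴹ_ = Congruence
      ; _+ᴹ_ = _⊕_
      ; _*ₗ_ = _·_
      ; 0ᴹ = 𝟘
      ; -ᴹ_ = λ t → (𝕂.- 1#) · t
      ; isLeftModule = record
        { isLeftSemimodule = record
          { +ᴹ-isCommutativeMonoid = record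
            { isMonoid = record
              { isSemigroup = record
                { isMagma = record
                  { isEquivalence = record { refl = ≈-refl ; sym = ≈-sym ; trans = ≈-trans }
                  ; ∙-cong = ⊕-cong
                  }
                ; assoc = ⊕-assoc
                }
              ; identity = ⊕-identity , (λ t → ≈-trans (⊕-comm t 𝟘) (⊕-identity t))
              }
            ; comm = ⊕-comm
            }
          ; isPreleftSemimodule = record
            { *ₗ-cong      = ·-cong
            ; *ₗ-zeroˡ     = ·-zero
            ; *ₗ-distribʳ  = ·-distribʳ
            ; *ₗ-identityˡ = ·-identity
            ; *ₗ-assoc     = ·-assoc
            ; *ₗ-zeroʳ     = λ k → ≈-trans (·-cong 𝕂.refl (≈-sym (·-zero 𝟘)))
                (≈-trans (≈-sym (·-assoc k 0# 𝟘))
                  (≈-trans (·-cong (𝕂.zeroʳ k) ≈-refl) (·-zero 𝟘)))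
            ; *ₗ-distribˡ  = ·-distribˡ
            }
          }
        ; -ᴹ‿cong = ·-cong 𝕂.refl
        ; -ᴹ‿inverse = inverseˡ , (λ t → ≈-trans (⊕-comm t _) (inverseˡ t))
        }
      }
      where
      inverseˡ : ∀ t → Congruence ((𝕂.- 1#) · t ⊕ t) 𝟘
      inverseˡ t = ≈-trans (⊕-cong ≈-refl (≈-sym (·-identity t)))
        (≈-trans (≈-sym (·-distribʳ t (𝕂.- 1#) 1#))
          (≈-trans (·-cong (𝕂.-‿inverseˡ 1#) ≈-refl) (·-zero t)))

    module _ (N : VectorSpace n ℓn) where
      private module N = LeftModule N

      eval : (B → N.Carrierᴹ) → Term B → N.Carrierᴹ
      eval f (gen x) = f x
      eval f 𝟘       = N.0ᴹ
      eval f (s ⊕ t) = eval f s N.+ᴹ eval f t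
      eval f (k · t) = k N.*ₗ eval f t

      extend : (f : B → N.Carrierᴹ) → (∀ {s t} → R s t → eval f s N.≈ᴹ eval f t) → Presented ⊸ N
      extend f f-rel = linear (eval f) eval-cong (λ _ _ → N.≈ᴹ-refl) (λ _ _ → N.≈ᴹ-refl)
        where
        eval-cong : ∀ {s t} → Congruence s t → eval f s N.≈ᴹ eval f t
        eval-cong (rel r)            = f-rel r
        eval-cong ≈-refl             = N.≈ᴹ-refl
        eval-cong (≈-sym e)          = N.≈ᴹ-sym (eval-cong e)
        eval-cong (≈-trans e e′)     = N.≈ᴹ-trans (eval-cong e) (eval-cong e′)
        eval-cong (⊕-cong e e′)      = N.+ᴹ-cong (eval-cong e) (eval-cong e′)
        eval-cong (·-cong k e)       = N.*ₗ-cong k (eval-cong e)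
        eval-cong (⊕-assoc s t u)    = N.+ᴹ-assoc _ _ _
        eval-cong (⊕-comm s t)       = N.+ᴹ-comm _ _
        eval-cong (⊕-identity t)     = N.+ᴹ-identityˡ _
        eval-cong (·-distribˡ k s t) = N.*ₗ-distribˡ k _ _
        eval-cong (·-distribʳ t k l) = N.*ₗ-distribʳ _ k l
        eval-cong (·-assoc k l t)    = N.*ₗ-assoc k l _
        eval-cong (·-identity t)     = N.*ₗ-identityˡ _
        eval-cong (·-zero t)         = N.*ₗ-zeroˡ _

    gen-ext : {N : VectorSpace n ℓn} {f g : Presented ⊸ N} →
              (∀ x → LeftModule._≈ᴹ_ N (⟦ f ⟧ (gen x)) (⟦ g ⟧ (gen x))) → f ≐ g
    gen-ext {N = N} {f} {g} e = pointwise go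
      where
      module f = _⊸_ f
      module g = _⊸_ g
      open LeftModule N
      go : ∀ t → ⟦ f ⟧ t ≈ᴹ ⟦ g ⟧ t
      go (gen x) = e x
      go 𝟘       = ≈ᴹ-trans f.0ᴹ-homo (≈ᴹ-sym g.0ᴹ-homo)
      go (s ⊕ t) = ≈ᴹ-trans (f.+ᴹ-homo s t) (≈ᴹ-trans (+ᴹ-cong (go s) (go t)) (≈ᴹ-sym (g.+ᴹ-homo s t)))
      go (k · t) = ≈ᴹ-trans (f.*ₗ-homo k t) (≈ᴹ-trans (*ₗ-cong 𝕂.refl (go t)) (≈ᴹ-sym (g.*ₗ-homo k t)))

  module _ {s ℓs : Level} (S : Setoid s ℓs) where
    private module S = Setoid S

    data BasisRel : Rel (Term S.Carrier) (c ⊔ s ⊔ ℓs) where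
      gen-cong : ∀ {x y} → x S.≈ y → BasisRel (gen x) (gen y)

    Free : VectorSpace (c ⊔ s) (c ⊔ ℓ₁ ⊔ s ⊔ ℓs)
    Free = Presented BasisRel

    extendFree : {N : VectorSpace n ℓn} → let module N = LeftModule N in
                 (f : S.Carrier → N.Carrierᴹ) → (∀ {x y} → x S.≈ y → f x N.≈ᴹ f y) → Free ⊸ N
    extendFree {N = N} f f-cong = extend BasisRel N f (λ { (gen-cong x≈y) → f-cong x≈y })

  module _ (M : VectorSpace m ℓm) (N : VectorSpace n ℓn) where
    private
      module M = LeftModule M
      module N = LeftModule N

    data TensorRel : Rel (Term (M.Carrierᴹ × N.Carrierᴹ)) (c ⊔ m ⊔ ℓm ⊔ n ⊔ ℓn) where
      ⊗-cong : ∀ {x x′ y y′} → x M.≈ᴹ x′ → y N.≈ᴹ y′ → TensorRel (gen (x , y)) (gen (x′ , y′))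
      ⊗-+ˡ   : ∀ x x′ y → TensorRel (gen (x M.+ᴹ x′ , y)) (gen (x , y) ⊕ gen (x′ , y))
      ⊗-+ʳ   : ∀ x y y′ → TensorRel (gen (x , y N.+ᴹ y′)) (gen (x , y) ⊕ gen (x , y′))
      ⊗-*ˡ   : ∀ k x y → TensorRel (gen (k M.*ₗ x , y)) (k · gen (x , y))
      ⊗-*ʳ   : ∀ k x y → TensorRel (gen (x , k N.*ₗ y)) (k · gen (x , y))

    infixr 7 _⊗_

    _⊗_ : VectorSpace (c ⊔ m ⊔ n) (c ⊔ ℓ₁ ⊔ m ⊔ ℓm ⊔ n ⊔ ℓn)
    _⊗_ = Presented TensorRel

  infixr 7 _⊗ᵗ_ _⊗₁_

  _⊗ᵗ_ : {M : VectorSpace m ℓm} {N : VectorSpace n ℓn} → Carrierᴹ M → Carrierᴹ N → Carrierᴹ (M ⊗ N)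
  x ⊗ᵗ y = gen (x , y)

  tensorˡ : {M : VectorSpace m ℓm} {N : VectorSpace n ℓn} → Carrierᴹ M → N ⊸ M ⊗ N
  tensorˡ {M = M} {N} x = linear (λ y → _⊗ᵗ_ {M = M} {N} x y)
    (λ y≈y′ → rel (⊗-cong (LeftModule.≈ᴹ-refl M) y≈y′))
    (λ y y′ → rel (⊗-+ʳ x y y′)) (λ k y → rel (⊗-*ʳ k x y))

  uncurry⊗ : {M : VectorSpace m ℓm} {N : VectorSpace n ℓn} {P : VectorSpace p ℓp} →
             M ⊸ Hom N P → M ⊗ N ⊸ P
  uncurry⊗ {M = M} {N} {P} f = extend (TensorRel M N) P (λ (x , y) → ⟦ ⟦ f ⟧ x ⟧ y) λ
    { (⊗-cong {x} {x′} {y} {y′} x≈x′ y≈y′) →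
        LeftModule.≈ᴹ-trans P (_⊸_.⟦⟧-cong (⟦ f ⟧ x) y≈y′) (at (f.⟦⟧-cong x≈x′) y′)
    ; (⊗-+ˡ x x′ y) → at (f.+ᴹ-homo x x′) y
    ; (⊗-+ʳ x y y′) → _⊸_.+ᴹ-homo (⟦ f ⟧ x) y y′
    ; (⊗-*ˡ k x y)  → at (f.*ₗ-homo k x) y
    ; (⊗-*ʳ k x y)  → _⊸_.*ₗ-homo (⟦ f ⟧ x) k y
    }
    where module f = _⊸_ f

  _⊗₁_ : {M : VectorSpace m ℓm} {N : VectorSpace n ℓn} {P : VectorSpace p ℓp} {Q : VectorSpace q ℓq} →
         M ⊸ P → N ⊸ Q → M ⊗ N ⊸ P ⊗ Q
  _⊗₁_ {M = M} {N} {P} {Q} f g = uncurry⊗ (linear (λ x → tensorˡ (⟦ f ⟧ x) ∘ₗ g)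
    (λ x≈x′ → pointwise λ y → rel (⊗-cong (f.⟦⟧-cong x≈x′) (LeftModule.≈ᴹ-refl Q)))
    (λ x x′ → pointwise λ y → ≈-trans (rel (⊗-cong (f.+ᴹ-homo x x′) (LeftModule.≈ᴹ-refl Q))) (rel (⊗-+ˡ _ _ _)))
    (λ k x → pointwise λ y → ≈-trans (rel (⊗-cong (f.*ₗ-homo k x) (LeftModule.≈ᴹ-refl Q))) (rel (⊗-*ˡ _ _ _))))
    where module f = _⊸_ f

  assoc⊗ : {M : VectorSpace m ℓm} {N : VectorSpace n ℓn} {P : VectorSpace p ℓp} →
           (M ⊗ N) ⊗ P ⊸ M ⊗ (N ⊗ P)
  assoc⊗ {M = M} {N} {P} = uncurry⊗ (uncurry⊗ (linear bilinear
    (λ x≈x′ → pointwise λ y → pointwise λ z → rel (⊗-cong x≈x′ ≈-refl))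
    (λ x x′ → pointwise λ y → pointwise λ z → rel (⊗-+ˡ x x′ _))
    (λ k x → pointwise λ y → pointwise λ z → rel (⊗-*ˡ k x _))))
    where
    bilinear : Carrierᴹ M → N ⊸ Hom P (M ⊗ (N ⊗ P))
    bilinear x = linear (λ y → tensorˡ x ∘ₗ tensorˡ y)
      (λ y≈y′ → pointwise λ z → rel (⊗-cong (LeftModule.≈ᴹ-refl M) (rel (⊗-cong y≈y′ (LeftModule.≈ᴹ-refl P)))))
      (λ y y′ → pointwise λ z → ≈-trans (rel (⊗-cong (LeftModule.≈ᴹ-refl M) (rel (⊗-+ˡ y y′ z)))) (rel (⊗-+ʳ x _ _)))
      (λ k y → pointwise λ z → ≈-trans (rel (⊗-cong (LeftModule.≈ᴹ-refl M) (rel (⊗-*ˡ k y z)))) (rel (⊗-*ʳ k x _)))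

  -- Id ⊗ c ⊗ Id: (a ⊗ b) ⊗ (a′ ⊗ b′) ↦ (a ⊗ a′) ⊗ (b ⊗ b′)
  interchange⊗ : {M : VectorSpace m ℓm} {N : VectorSpace n ℓn} {P : VectorSpace p ℓp} {Q : VectorSpace q ℓq} →
                 (M ⊗ N) ⊗ (P ⊗ Q) ⊸ (M ⊗ P) ⊗ (N ⊗ Q)
  interchange⊗ {M = M} {N} {P} {Q} = uncurry⊗ (uncurry⊗ (linear bilinear
    (λ a≈a′ → pointwise λ b → gen-ext (TensorRel P Q) λ _ → rel (⊗-cong (rel (⊗-cong a≈a′ P.≈ᴹ-refl)) ≈-refl))
    (λ a a′ → pointwise λ b → gen-ext (TensorRel P Q) λ (c , d) →
      ≈-trans (rel (⊗-cong (rel (⊗-+ˡ a a′ c)) ≈-refl)) (rel (⊗-+ˡ _ _ _)))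
    (λ k a → pointwise λ b → gen-ext (TensorRel P Q) λ (c , d) →
      ≈-trans (rel (⊗-cong (rel (⊗-*ˡ k a c)) ≈-refl)) (rel (⊗-*ˡ k _ _)))))
    where
    module P = LeftModule P
    module Q = LeftModule Q
    bilinear : Carrierᴹ M → N ⊸ Hom (P ⊗ Q) ((M ⊗ P) ⊗ (N ⊗ Q))
    bilinear a = linear (λ b → tensorˡ a ⊗₁ tensorˡ b)
      (λ b≈b′ → gen-ext (TensorRel P Q) λ _ → rel (⊗-cong ≈-refl (rel (⊗-cong b≈b′ Q.≈ᴹ-refl))))
      (λ b b′ → gen-ext (TensorRel P Q) λ (c , d) →
        ≈-trans (rel (⊗-cong ≈-refl (rel (⊗-+ˡ b b′ d)))) (rel (⊗-+ʳ _ _ _)))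
      (λ k b → gen-ext (TensorRel P Q) λ (c , d) →
        ≈-trans (rel (⊗-cong ≈-refl (rel (⊗-*ˡ k b d)))) (rel (⊗-*ʳ k _ _)))

  -- k ⊗ x ↦ k x
  unitˡ⊗ : {M : VectorSpace m ℓm} → 𝕂ᴹ ⊗ M ⊸ M
  unitˡ⊗ {M = M} = uncurry⊗ (linear (_*ₗ idₗ) (λ k≈l → *ₗ-cong k≈l (≈ᴹ-refl {idₗ}))
    (λ k l → *ₗ-distribʳ idₗ k l) (λ k l → *ₗ-assoc k l idₗ))
    where open LeftModule (Hom M M)

  -- x ⊗ k ↦ k x
  unitʳ⊗ : {M : VectorSpace m ℓm} → M ⊗ 𝕂ᴹ ⊸ M
  unitʳ⊗ {M = M} = uncurry⊗ (linear
    (λ x → linear (_*ₗ x) (λ k≈l → *ₗ-cong k≈l ≈ᴹ-refl) (λ k l → *ₗ-distribʳ x k l) (λ k l → *ₗ-assoc k l x))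
    (λ x≈y → pointwise λ k → *ₗ-cong 𝕂.refl x≈y)
    (λ x y → pointwise λ k → *ₗ-distribˡ k x y)
    (λ l x → pointwise λ k → ≈ᴹ-trans (≈ᴹ-sym (*ₗ-assoc k l x))
      (≈ᴹ-trans (*ₗ-cong (𝕂.*-comm k l) ≈ᴹ-refl) (*ₗ-assoc l k x))))
    where open LeftModule M

  ----------------------------------------------------------------------

  record Species (p ℓp : Level) : Set (lsuc 0ℓ ⊔ c ⊔ ℓ₁ ⊔ lsuc (p ⊔ ℓp)) where
    field
      _[_]     : FiniteSet → VectorSpace p ℓp
      act      : ∀ {X Y} → X ≃ Y → _[_] X ⊸ _[_] Y
      act-cong : ∀ {X Y} {σ τ : X ≃ Y} →
                 (∀ x → FiniteSet._≈_ Y (Inverse.to σ x) (Inverse.to τ x)) →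
                 act {X} {Y} σ ≐ act {X} {Y} τ
      act-id   : ∀ {X} → act {X} {X} (≃-id {X}) ≐ idₗ
      act-∘    : ∀ {X Y Z} (τ : Y ≃ Z) (σ : X ≃ Y) →
                 act {X} {Z} (_≃∘_ {X} {Y} {Z} τ σ) ≐ act {Y} {Z} τ ∘ₗ act {X} {Y} σ

  open Species public using (_[_])

  module _ (P : Species p ℓp) where
    open Species P using (act)

    -- Only the operations of a twisted bialgebra: compatibility with δ
    -- does not refer to the axioms.
    record RawTwistedBialgebra : Set (lsuc 0ℓ ⊔ c ⊔ ℓ₁ ⊔ p ⊔ ℓp) where
      field
        μ : ∀ X Y → P [ X ] ⊗ P [ Y ] ⊸ P [ X ⊍ Y ]
        Δ : ∀ X Y → P [ X ⊍ Y ] ⊸ P [ X ] ⊗ P [ Y ]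
        𝟏 : Carrierᴹ (P [ ∅ ])
        ε : P [ ∅ ] ⊸ 𝕂ᴹ

    Coproducts : Set (lsuc 0ℓ ⊔ c ⊔ ℓ₁ ⊔ p ⊔ ℓp)
    Coproducts = ∀ {X} (s : 𝓔 X) → P [ X ] ⊸ P [ X / s ] ⊗ P [ X ]

    record IsContractionExtraction (δ : Coproducts) : Set (lsuc 0ℓ ⊔ c ⊔ ℓ₁ ⊔ p ⊔ ℓp) where
      field
        -- δ depends only on the extension of the equivalence.
        δ-cong : ∀ {X} {r s : 𝓔 X} (r≈s : r ≈ᴱ s) →
          (act (/-cong {r = r} {s} r≈s) ⊗₁ idₗ) ∘ₗ δ r ≐ δ s

        δ-natural : ∀ {X Y} (σ : X ≃ Y) (s : 𝓔 X) →
          δ (transport {X} {Y} σ s) ∘ₗ act {X} {Y} σ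
            ≐ (act (/-map {X} {Y} σ s) ⊗₁ act {X} {Y} σ) ∘ₗ δ s

        -- assoc⊗ and /-/ express the identifications of the two codomains.
        δ-coassoc : ∀ {X} {r s : 𝓔 X} (r≤s : r ≤ᴱ s) →
          assoc⊗ ∘ₗ (((act (/-/ {r = r} {s} r≤s) ⊗₁ idₗ) ∘ₗ δ (_over_ r {s} r≤s)) ⊗₁ idₗ) ∘ₗ δ s
            ≐ (idₗ ⊗₁ δ s) ∘ₗ δ r

        δ-coassoc-0 : ∀ {X} {r s : 𝓔 X} → ¬ (r ≤ᴱ s) →
          (idₗ ⊗₁ δ s) ∘ₗ δ r ≐ 0ₗ

        ϵ : ∀ X → P [ X ] ⊸ 𝕂ᴹ

        ϵ-natural : ∀ {X Y} (σ : X ≃ Y) → ϵ Y ∘ₗ act {X} {Y} σ ≐ ϵ X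

        ϵ-right : ∀ {X} {s : 𝓔 X} (s≈ : s ≈ᴱ discrete X) →
          act (/-discrete {s = s} s≈) ∘ₗ unitʳ⊗ ∘ₗ (idₗ ⊗₁ ϵ X) ∘ₗ δ s ≐ idₗ

        ϵ-right-0 : ∀ {X} {s : 𝓔 X} → ¬ (s ≈ᴱ discrete X) →
          unitʳ⊗ ∘ₗ (idₗ ⊗₁ ϵ X) ∘ₗ δ s ≐ 0ₗ

        ϵ-left : ∀ X →
          sumₗ (map (λ s → unitˡ⊗ ∘ₗ (ϵ (X / s) ⊗₁ idₗ) ∘ₗ δ s) (equivalences X)) ≐ idₗ

  module _ {P : Species p ℓp} (B : RawTwistedBialgebra P) where
    open Species P using (act)
    open RawTwistedBialgebra B

    record IsCompatible (δ : Coproducts P) : Set (lsuc 0ℓ ⊔ c ⊔ ℓ₁ ⊔ p ⊔ ℓp) where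
      field
        δ-μ : ∀ {X Y} (s : 𝓔 (X ⊍ Y)) (split : Splits s) →
          (act (/-⊍ s split) ⊗₁ idₗ) ∘ₗ δ s ∘ₗ μ X Y
            ≐ (μ (X / s ∣₁) (Y / s ∣₂) ⊗₁ μ X Y) ∘ₗ interchange⊗ ∘ₗ (δ (s ∣₁) ⊗₁ δ (s ∣₂))

        δ-μ-0 : ∀ {X Y} (s : 𝓔 (X ⊍ Y)) → ¬ Splits s → δ s ∘ₗ μ X Y ≐ 0ₗ

        δ-Δ : ∀ {X Y} (s : 𝓔 (X ⊍ Y)) (split : Splits s) →
          ((Δ (X / s ∣₁) (Y / s ∣₂) ∘ₗ act (/-⊍ s split)) ⊗₁ idₗ) ∘ₗ δ s
            ≐ (idₗ ⊗₁ μ X Y) ∘ₗ interchange⊗ ∘ₗ (δ (s ∣₁) ⊗₁ δ (s ∣₂)) ∘ₗ Δ X Y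

        δ-𝟏 : LeftModule._≈ᴹ_ (P [ ∅ ] ⊗ P [ ∅ ])
          (⟦ (act ∅/discrete ⊗₁ idₗ) ∘ₗ δ (discrete ∅) ⟧ 𝟏)
          (_⊗ᵗ_ {M = P [ ∅ ]} {P [ ∅ ]} 𝟏 𝟏)

        δ-ε : ∀ x → LeftModule._≈ᴹ_ (P [ ∅ ])
          (⟦ unitˡ⊗ ∘ₗ ((ε ∘ₗ act ∅/discrete) ⊗₁ idₗ) ∘ₗ δ (discrete ∅) ⟧ x)
          (LeftModule._*ₗ_ (P [ ∅ ]) (⟦ ε ⟧ x) 𝟏)

  ----------------------------------------------------------------------

  graph : ∀ {X} → Graph X → Carrierᴹ (Free (𝓖 X))
  graph G = gen G

  graph-cong : ∀ {X} {G H : Graph X} → G ≈ᴳ H →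
               LeftModule._≈ᴹ_ (Free (𝓖 X)) (graph G) (graph H)
  graph-cong {X} {G} {H} e = rel (gen-cong {x = G} {H} e)
  infixr 7 _⊗ᴳ_

  _⊗ᴳ_ : ∀ {X Y} → Graph X → Graph Y → Carrierᴹ (Free (𝓖 X) ⊗ Free (𝓖 Y))
  _⊗ᴳ_ {X} {Y} G H = _⊗ᵗ_ {M = Free (𝓖 X)} {Free (𝓖 Y)} (graph G) (graph H)

  𝐆 : Species (lsuc 0ℓ ⊔ c) (lsuc 0ℓ ⊔ c ⊔ ℓ₁)
  𝐆 = record
    { _[_] = λ X → Free (𝓖 X)
    ; act = λ {X} {Y} σ → extendFree (𝓖 X) {N = Free (𝓖 Y)} (λ G → graph (relabel {X} {Y} σ G))
        (λ {G} {H} G≈H → graph-cong {G = relabel {X} {Y} σ G} {relabel {X} {Y} σ H} (proj₁ G≈H , proj₂ G≈H))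
    ; act-cong = λ {X} {Y} {σ} {τ} σ≗τ → gen-ext (BasisRel (𝓖 X)) λ G →
        graph-cong {G = relabel {X} {Y} σ G} {relabel {X} {Y} τ G}
          (relabel-cong {X} {Y} G σ τ σ≗τ , relabel-cong {X} {Y} G τ σ (λ x → FiniteSet.sym Y (σ≗τ x)))
    ; act-id = λ {X} → gen-ext (BasisRel (𝓖 X)) λ G →
        graph-cong {G = relabel {X} {X} (≃-id {X}) G} {G} (id , id)
    ; act-∘ = λ {X} {Y} {Z} τ σ → gen-ext (BasisRel (𝓖 X)) λ G →
        graph-cong {G = relabel {X} {Z} (_≃∘_ {X} {Y} {Z} τ σ) G}
          {relabel {Y} {Z} τ (relabel {X} {Y} σ G)} (id , id)
    }
    where
    relabel-cong : ∀ {X Y} (G : Graph X) (σ τ : X ≃ Y) →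
      (∀ x → FiniteSet._≈_ Y (Inverse.to σ x) (Inverse.to τ x)) →
      Graph.Adj (relabel {X} {Y} σ G) ⇒ Graph.Adj (relabel {X} {Y} τ G)
    relabel-cong {X} {Y} G σ τ σ≗τ {x} {y} a = proj₁ adj-resp (from≗ y) (proj₂ adj-resp (from≗ x) a)
      where
      open Graph G
      module X = FiniteSet X
      module Y = FiniteSet Y
      from≗ : ∀ y → X._≈_ (Inverse.from σ y) (Inverse.from τ y)
      from≗ y = X.sym (Inverse.inverseʳ τ
        (Y.trans (Y.sym (Inverse.strictlyInverseˡ σ y)) (σ≗τ (Inverse.from σ y))))

  𝐆-bialgebra : RawTwistedBialgebra 𝐆
  𝐆-bialgebra = record
    { μ = λ X Y → uncurry⊗ (extendFree (𝓖 X) {N = Hom (Free (𝓖 Y)) (Free (𝓖 (X ⊍ Y)))}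
        (λ G → extendFree (𝓖 Y) {N = Free (𝓖 (X ⊍ Y))} (λ H → graph (G ⊍ᴳ H))
          (λ {H} {H′} H≈H′ → union-cong {X} {Y} {G} {G} {H} {H′} (id , id) H≈H′))
        (λ {G} {G′} G≈G′ → gen-ext (BasisRel (𝓖 Y)) λ H →
          union-cong {X} {Y} {G} {G′} {H} {H} G≈G′ (id , id)))
    ; Δ = λ X Y → extendFree (𝓖 (X ⊍ Y)) {N = Free (𝓖 X) ⊗ Free (𝓖 Y)}
        (λ G → (G ↾ ι₁ {X} {Y}) ⊗ᴳ (G ↾ ι₂ {X} {Y}))
        (λ {G} {H} G≈H → rel (⊗-cong
          (graph-cong {G = G ↾ ι₁ {X} {Y}} {H ↾ ι₁ {X} {Y}} (proj₁ G≈H , proj₂ G≈H))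
          (graph-cong {G = G ↾ ι₂ {X} {Y}} {H ↾ ι₂ {X} {Y}} (proj₁ G≈H , proj₂ G≈H))))
    ; 𝟏 = graph emptyGraph
    ; ε = extendFree (𝓖 ∅) {N = 𝕂ᴹ} (λ _ → 1#) (λ _ → 𝕂.refl)
    }
    where
    union-cong : ∀ {X Y} {G G′ : Graph X} {H H′ : Graph Y} → G ≈ᴳ G′ → H ≈ᴳ H′ →
      LeftModule._≈ᴹ_ (Free (𝓖 (X ⊍ Y))) (graph (G ⊍ᴳ H)) (graph (G′ ⊍ᴳ H′))
    union-cong {G = G} {G′} {H} {H′} (G⇒ , G⇐) (H⇒ , H⇐) =
      graph-cong {G = G ⊍ᴳ H} {G′ ⊍ᴳ H′}
        ((λ { (inj₁ a) → inj₁ (G⇒ a) ; (inj₂ a) → inj₂ (H⇒ a) })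
        , (λ { (inj₁ a) → inj₁ (G⇐ a) ; (inj₂ a) → inj₂ (H⇐ a) }))

  δ : Coproducts 𝐆
  δ {X} s = extendFree (𝓖 X) {N = Free (𝓖 (X / s)) ⊗ Free (𝓖 X)} δ-graph
    (λ {G} {H} → δ-graph-cong {G} {H})
    where
    open LeftModule (Free (𝓖 (X / s)) ⊗ Free (𝓖 X)) using (0ᴹ; _≈ᴹ_; ≈ᴹ-refl)
    δ-graph : Graph X → Carrierᴹ (Free (𝓖 (X / s)) ⊗ Free (𝓖 X))
    δ-graph G = if does (∈𝓔c? s G) then (G /ᴳ s) ⊗ᴳ (G ∣ᴳ s) else 0ᴹ
    δ-graph-cong : ∀ {G H} → G ≈ᴳ H → δ-graph G ≈ᴹ δ-graph H
    δ-graph-cong {G} {H} G≈H@(G⇒H , H⇒G) with ∈𝓔c? s G | ∈𝓔c? s H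
    ... | yes _ | yes _ = rel (⊗-cong
      (graph-cong {G = G /ᴳ s} {H /ᴳ s}
        ( (λ (n , x , y , p , q , a) → n , x , y , p , q , G⇒H a)
        , (λ (n , x , y , p , q , a) → n , x , y , p , q , H⇒G a)))
      (graph-cong {G = G ∣ᴳ s} {H ∣ᴳ s}
        ((λ (a , p) → G⇒H a , p) , (λ (a , p) → H⇒G a , p))))
    ... | yes c | no ¬c = contradiction (𝓔c-cong s {G} {H} G≈H c) ¬c
    ... | no ¬c | yes c = contradiction (𝓔c-cong s {H} {G} (H⇒G , G⇒H) c) ¬c
    ... | no _  | no _  = ≈ᴹ-refl

{-# OPTIONS --safe #-}

-- A relation ∼ lies in 𝓔c[G] iff ∼-equivalent vertices are joined by a
-- walk in G ∣ ∼.  In this form connectedness is stable under relabelling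
-- and under disjoint unions, and for s finer than r one has
-- s ∈ 𝓔c[G], r/s ∈ 𝓔c[G/s] iff r ∈ 𝓔c[G], s ∈ 𝓔c[G ∣ r]: contract the
-- steps of a walk inside classes of s, or expand a step of G/s by walks
-- inside such classes.  This is coassociativity; if s is not finer than
-- r, then s ∉ 𝓔c[G ∣ r] since walks in G ∣ r stay in a class of r.
-- The counit ϵ is 1 on graphs without edges and 0 on the others.  The only
-- ∼ ∈ 𝓔c[G] for which G ∣ ∼ has no edge is the equality, and the only
-- one for which G/∼ has no edge is the relation whose classes are the
-- connected components of G.

module Submission where

open import Level using (Level)
open import Algebra.Apartness.Bundles using (HeytingField)
open import Algebra.Bundles using (CommutativeRing)
open import Algebra.Module.Bundles using (LeftModule)
open import Data.Bool.Base using (Bool; if_then_else_)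
open import Data.List.Base using (List; []; _∷_; map; cartesianProduct)
open import Data.List.Relation.Unary.All using (All; []; _∷_)
import Data.List.Relation.Unary.All as All
open import Data.List.Relation.Unary.AllPairs using ([]; _∷_)
open import Data.List.Relation.Unary.Any using (Any; here; there)
import Data.List.Relation.Unary.Any.Properties as Any
open import Data.List.Relation.Unary.Unique.DecSetoid using (Unique)
open import Data.Product.Base using (∃; _×_; _,_; proj₁; proj₂)
open import Data.Sum.Base using (inj₁; inj₂)
open import Data.Sum.Relation.Binary.Pointwise using (Pointwise; inj₁; inj₂)
open import Function.Base using (id; _∘_)
open import Function.Bundles using (Func; Inverse; mk⇔)
import Function.Construct.Identity as Identity
open import Relation.Binary.Bundles using (DecSetoid)
open import Relation.Binary.Core using (_⇒_)
open import Relation.Binary.PropositionalEquality.Core as ≡ using (_≡_; cong)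
open import Relation.Nullary using (¬_; Dec; yes; no; does; contradiction)
open import Relation.Nullary.Decidable using (dec-true; dec-false; decidable-stable; does-⇔; ¬?)
open import Defs

private
  variable
    X Y : FiniteSet

-- Walks and connectedness of classes

Walk-cong : (G : Graph X) → let open FiniteSet X in
            ∀ {x x′ y y′} → x ≈ x′ → y ≈ y′ → Walk G x y → Walk G x′ y′
Walk-cong {X} G x≈x′ y≈y′ w =
  _++ʷ_ G (stop (FiniteSet.sym X x≈x′)) (_++ʷ_ G w (stop y≈y′))

Walk-mono : {G H : Graph X} → Graph.Adj G ⇒ Graph.Adj H → Walk G ⇒ Walk H
Walk-mono {X} {G} {H} h = Walk-map {X} {X} {G} {H} (Identity.function (FiniteSet.setoid X)) h

-- Reachability is the least reflexive and transitive relation containing adjacency. Every bound on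
-- how far walks can go is obtained from this.
Walk⇒𝓔 : (s : 𝓔 X) {G : Graph X} → Graph.Adj G ⇒ 𝓔._∼_ s → Walk G ⇒ 𝓔._∼_ s
Walk⇒𝓔 s h (stop p)   = 𝓔.≈⇒∼ s p
Walk⇒𝓔 s h (step a w) = 𝓔.∼-trans s (h a) (Walk⇒𝓔 s h w)

module _ (s : 𝓔 X) (G : Graph X) where
  open 𝓔 s

  -- Both ends of an edge inside the class of `x` are equivalent to `x`, hence to each other, so the
  -- edge survives in `G ∣ᴳ s`.
  𝓔c⇒walk : s ∈𝓔c G → _∼_ ⇒ Walk (G ∣ᴳ s)
  𝓔c⇒walk c {x} {y} x∼y =
    Walk-map {Class s x} {X} {_↾_ {X} {Class s x} G (class⃗ s x)} {G ∣ᴳ s} (class⃗ s x)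
      (λ {u} {v} a → a , ∼-trans (∼-sym (proj₂ u)) (proj₂ v))
      (c x (x , ∼-refl) (y , x∼y))

  -- Each step of a walk in `G ∣ᴳ s` is along `∼`, so membership in the class of `x` is carried from
  -- vertex to vertex. Equality in `Class s x` ignores the membership proofs, which settles the end
  -- of the walk.
  walk⇒𝓔c : _∼_ ⇒ Walk (G ∣ᴳ s) → s ∈𝓔c G
  walk⇒𝓔c h x (u , x∼u) (v , x∼v) = lift (h (∼-trans (∼-sym x∼u) x∼v))
    where
    lift : ∀ {u v} {x∼u : x ∼ u} {x∼v : x ∼ v} →
           Walk (G ∣ᴳ s) u v → Walk (_↾_ {X} {Class s x} G (class⃗ s x)) (u , x∼u) (v , x∼v)
    lift             (stop p)         = stop p
    lift {x∼u = x∼u} (step (a , p) w) = step {y = _ , ∼-trans x∼u p} a (lift w)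

-- Walks are pushed forward along `f`; the second hypothesis says that every pair to be joined comes
-- from a pair joined upstairs. Serves relabelling in both directions.
𝓔c-map : {s : 𝓔 X} {G : Graph X} {t : 𝓔 Y} {H : Graph Y} (f : X ⟶ Y) → let open Func f in
  (∀ {x y} → Graph.Adj (G ∣ᴳ s) x y → Graph.Adj (H ∣ᴳ t) (to x) (to y)) →
  (∀ {x y} → 𝓔._∼_ t x y → ∃ λ x′ → ∃ λ y′ →
    FiniteSet._≈_ Y (to x′) x × FiniteSet._≈_ Y (to y′) y × 𝓔._∼_ s x′ y′) →
  s ∈𝓔c G → t ∈𝓔c H
𝓔c-map {s = s} {G} {t} {H} f h lift c = walk⇒𝓔c t H λ x∼y →
  let x′ , y′ , p , q , r = lift x∼y
  in Walk-cong (H ∣ᴳ t) p q (Walk-map {_} {_} {G ∣ᴳ s} {H ∣ᴳ t} f h (𝓔c⇒walk s G c r))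

-- Change of the equivalence, restriction and relabelling

𝓔c-congᴱ : {r s : 𝓔 X} (G : Graph X) → r ≈ᴱ s → r ∈𝓔c G → s ∈𝓔c G
𝓔c-congᴱ {r = r} {s} G (r⇒s , s⇒r) c = walk⇒𝓔c s G λ x∼y →
  Walk-mono {G = G ∣ᴳ r} {G ∣ᴳ s} (λ (a , p) → a , r⇒s p) (𝓔c⇒walk r G c (s⇒r x∼y))

module _ {r s : 𝓔 X} (G : Graph X) (r≈s : r ≈ᴱ s) where
  private
    r⇒s = proj₁ r≈s
    s⇒r = proj₂ r≈s

  /ᴳ-congᴱ : relabel {X / r} {X / s} (/-cong {r = r} {s} r≈s) (G /ᴳ r) ≈ᴳ G /ᴳ s
  /ᴳ-congᴱ =
      (λ (n , x , y , p , q , a) → (λ x∼y → n (s⇒r x∼y)) , x , y , r⇒s p , r⇒s q , a)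
    , (λ (n , x , y , p , q , a) → (λ x∼y → n (r⇒s x∼y)) , x , y , s⇒r p , s⇒r q , a)

  ∣ᴳ-congᴱ : G ∣ᴳ r ≈ᴳ G ∣ᴳ s
  ∣ᴳ-congᴱ = (λ (a , p) → a , r⇒s p) , (λ (a , p) → a , s⇒r p)

discrete-𝓔c : (G : Graph X) → discrete X ∈𝓔c G
discrete-𝓔c {X} G = walk⇒𝓔c (discrete X) G stop

-- The second hypothesis makes the image of `f` a union of classes of `s`, so a walk in `G ∣ᴳ s`
-- that starts in the image never leaves it; injectivity brings its end back to `Y`.
𝓔c-↾ : (f : Y ⟶ X) (s : 𝓔 X) (G : Graph X) → let open Func f in
  (∀ {x y} → FiniteSet._≈_ X (to x) (to y) → FiniteSet._≈_ Y x y) →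
  (∀ {x z} → 𝓔._∼_ s (to x) z → ∃ λ y → FiniteSet._≈_ X z (to y)) →
  s ∈𝓔c G → _↾ᴱ_ {X} {Y} s f ∈𝓔c _↾_ {X} {Y} G f
𝓔c-↾ {Y} {X} f s G inj closed c = walk⇒𝓔c s′ G′
  λ x∼y → lift (FiniteSet.refl X) (FiniteSet.refl X) (𝓔c⇒walk s G c x∼y)
  where
  open Func f
  open FiniteSet X
  open 𝓔 s
  open Graph G
  s′ = _↾ᴱ_ {X} {Y} s f
  G′ = _↾_ {X} {Y} G f
  -- The ends are images of `f` only up to `≈`, because `closed` yields the next vertex only up to
  -- `≈`.
  lift : ∀ {x y x′ y′} → x′ ≈ to x → y′ ≈ to y → Walk (G ∣ᴳ s) x′ y′ →
         Walk (G′ ∣ᴳ s′) x y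
  lift x′≈ y′≈ (stop p)         = stop (inj (trans (sym x′≈) (trans p y′≈)))
  lift x′≈ y′≈ (step (a , p) w) =
    let p′      = ∼-trans (≈⇒∼ (sym x′≈)) p
        u , z≈u = closed p′
    in step (proj₁ adj-resp z≈u (proj₂ adj-resp x′≈ a) , ∼-trans p′ (≈⇒∼ z≈u)) (lift z≈u y′≈ w)

module _ (σ : X ≃ Y) (G : Graph X) where
  open Inverse σ
  open Graph G
  private module X = FiniteSet X

  relabel⁺ : ∀ {x y} → Adj x y → Graph.Adj (relabel {X} {Y} σ G) (to x) (to y)
  relabel⁺ a = proj₁ adj-resp (X.sym (inverseʳ (FiniteSet.refl Y)))
    (proj₂ adj-resp (X.sym (inverseʳ (FiniteSet.refl Y))) a)

module _ (σ : X ≃ Y) (s : 𝓔 X) (G : Graph X) where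
  open Inverse σ
  open 𝓔 s
  open Graph G
  private
    module X = FiniteSet X
    module Y = FiniteSet Y

    from-to : ∀ x → from (to x) X.≈ x
    from-to _ = inverseʳ Y.refl

  𝓔c-relabel⁺ : s ∈𝓔c G → transport {X} {Y} σ s ∈𝓔c relabel {X} {Y} σ G
  𝓔c-relabel⁺ = 𝓔c-map {s = s} {G} {transport {X} {Y} σ s} {relabel {X} {Y} σ G}
    (record { to = to ; cong = to-cong })
    (λ {x} {y} (a , p) → relabel⁺ {X} {Y} σ G a
      , ∼-trans (≈⇒∼ (from-to x)) (∼-trans p (≈⇒∼ (X.sym (from-to y)))))
    (λ {x} {y} x∼y → from x , from y , inverseˡ X.refl , inverseˡ X.refl , x∼y)

  𝓔c-relabel⁻ : transport {X} {Y} σ s ∈𝓔c relabel {X} {Y} σ G → s ∈𝓔c G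
  𝓔c-relabel⁻ = 𝓔c-map {s = transport {X} {Y} σ s} {relabel {X} {Y} σ G} {s} {G}
    (inv⃗ {X} {Y} σ) id
    (λ {x} {y} x∼y → to x , to y , from-to x , from-to y
      , ∼-trans (≈⇒∼ (from-to x)) (∼-trans x∼y (≈⇒∼ (X.sym (from-to y)))))

  relabel-/ᴳ : relabel {X / s} {Y / transport {X} {Y} σ s} (/-map {X} {Y} σ s) (G /ᴳ s)
                 ≈ᴳ relabel {X} {Y} σ G /ᴳ transport {X} {Y} σ s
  relabel-/ᴳ =
      (λ (n , x , y , p , q , a) → n , to x , to y
        , ∼-trans p (≈⇒∼ (X.sym (from-to x))) , ∼-trans q (≈⇒∼ (X.sym (from-to y)))
        , relabel⁺ {X} {Y} σ G a)
    , (λ (n , x , y , p , q , a) → n , from x , from y , p , q , a)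

-- Nested equivalences: contraction and extraction in two stages

module _ {r s : 𝓔 X} (r≤s : r ≤ᴱ s) (G : Graph X) where
  private
    module R = 𝓔 r
    module S = 𝓔 s

  -- Classes of `s` lie inside classes of `r`, so passing to `G ∣ᴳ r` deletes no edge within a class
  -- of `s`.
  𝓔c-∣ᴳ⁺ : s ∈𝓔c G → s ∈𝓔c G ∣ᴳ r
  𝓔c-∣ᴳ⁺ c = walk⇒𝓔c s (G ∣ᴳ r) λ p →
    Walk-mono {G = G ∣ᴳ s} {(G ∣ᴳ r) ∣ᴳ s} (λ (a , q) → (a , r≤s q) , q) (𝓔c⇒walk s G c p)

  𝓔c-∣ᴳ⁻ : s ∈𝓔c G ∣ᴳ r → s ∈𝓔c G
  𝓔c-∣ᴳ⁻ c = walk⇒𝓔c s G λ p →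
    Walk-mono {G = (G ∣ᴳ r) ∣ᴳ s} {G ∣ᴳ s} (λ ((a , _) , q) → a , q) (𝓔c⇒walk s (G ∣ᴳ r) c p)

  𝓔c-over⁺ : r ∈𝓔c G → _over_ r {s} r≤s ∈𝓔c G /ᴳ s
  𝓔c-over⁺ c = walk⇒𝓔c (_over_ r {s} r≤s) (G /ᴳ s) λ p → contract (𝓔c⇒walk r G c p)
    where
    contract : Walk (G ∣ᴳ r) ⇒ Walk ((G /ᴳ s) ∣ᴳ (_over_ r {s} r≤s))
    contract (stop p) = stop (S.≈⇒∼ p)
    contract (step {x} {y} (a , p) w) with x S.∼? y
    -- A step inside a class of `s` is an equality in `X / s`, so it costs no edge of the quotient.
    ... | yes x∼y = _++ʷ_ ((G /ᴳ s) ∣ᴳ (_over_ r {s} r≤s)) (stop x∼y) (contract w)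
    ... | no  x≁y = step ((x≁y , x , y , S.∼-refl , S.∼-refl , a) , p) (contract w)

  𝓔c-over⁻ : s ∈𝓔c G → _over_ r {s} r≤s ∈𝓔c G /ᴳ s → r ∈𝓔c G
  𝓔c-over⁻ c d = walk⇒𝓔c r G λ p → expand (𝓔c⇒walk (_over_ r {s} r≤s) (G /ᴳ s) d p)
    where
    inside : S._∼_ ⇒ Walk (G ∣ᴳ r)
    inside p = Walk-mono {G = G ∣ᴳ s} {G ∣ᴳ r} (λ (a , q) → a , r≤s q) (𝓔c⇒walk s G c p)
    expand : Walk ((G /ᴳ s) ∣ᴳ (_over_ r {s} r≤s)) ⇒ Walk (G ∣ᴳ r)
    expand (stop p) = inside p
    expand (step ((_ , _ , _ , p , q , a) , x∼y) w) =
      -- An edge of the quotient comes from an edge between other members of the two classes: walk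
      -- to its first end within one class, cross it, and walk back within the other.
      _++ʷ_ (G ∣ᴳ r) (inside p) (step
        (a , R.∼-trans (R.∼-sym (r≤s p)) (R.∼-trans x∼y (r≤s q)))
        (_++ʷ_ (G ∣ᴳ r) (inside (S.∼-sym q)) (expand w)))

  -- This and the next two equalities match the three tensor factors of the two sides of
  -- coassociativity, from left to right.
  /ᴳ-/ᴳ : relabel {(X / s) / (_over_ r {s} r≤s)} {X / r} (/-/ {r = r} {s} r≤s) ((G /ᴳ s) /ᴳ (_over_ r {s} r≤s))
            ≈ᴳ G /ᴳ r
  /ᴳ-/ᴳ =
      (λ (n , _ , _ , p , q , _ , x , y , p′ , q′ , a) →
        n , x , y , R.∼-trans p (r≤s p′) , R.∼-trans q (r≤s q′) , a)
    , (λ (n , x , y , p , q , a) →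
        n , x , y , p , q
        -- Vertices in different classes of `r` lie in different classes of the finer `s`, so the
        -- edge survives the first contraction.
        , (λ x∼y → n (R.∼-trans p (R.∼-trans (r≤s x∼y) (R.∼-sym q))))
        , x , y , S.∼-refl , S.∼-refl , a)

  /ᴳ-∣ᴳ : (G /ᴳ s) ∣ᴳ (_over_ r {s} r≤s) ≈ᴳ (G ∣ᴳ r) /ᴳ s
  /ᴳ-∣ᴳ =
      (λ ((n , x , y , p , q , a) , x∼y) →
        n , x , y , p , q , a , R.∼-trans (R.∼-sym (r≤s p)) (R.∼-trans x∼y (r≤s q)))
    , (λ (n , x , y , p , q , a , x∼y) →
        (n , x , y , p , q , a) , R.∼-trans (r≤s p) (R.∼-trans x∼y (R.∼-sym (r≤s q))))

  ∣ᴳ-∣ᴳ : G ∣ᴳ s ≈ᴳ (G ∣ᴳ r) ∣ᴳ s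
  ∣ᴳ-∣ᴳ = (λ (a , p) → (a , r≤s p) , p) , (λ ((a , _) , p) → a , p)

𝓔c-∣ᴳ⇒≤ : {r s : 𝓔 X} (G : Graph X) → s ∈𝓔c G ∣ᴳ r → r ≤ᴱ s
𝓔c-∣ᴳ⇒≤ {r = r} {s} G c p =
  Walk⇒𝓔 r {(G ∣ᴳ r) ∣ᴳ s} (λ ((_ , q) , _) → q) (𝓔c⇒walk s (G ∣ᴳ r) c p)

-- Disjoint unions

infixl 7 _↾₁ _↾₂

_↾₁ : Graph (X ⊍ Y) → Graph X
_↾₁ {X} {Y} G = _↾_ {X ⊍ Y} {X} G (ι₁ {X} {Y})

_↾₂ : Graph (X ⊍ Y) → Graph Y
_↾₂ {X} {Y} G = _↾_ {X ⊍ Y} {Y} G (ι₂ {X} {Y})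

module _ (s : 𝓔 (X ⊍ Y)) (split : Splits {X} {Y} s) (G : Graph (X ⊍ Y)) where
  private module S = 𝓔 s

  -- When `s` splits, no class meets both summands, so each summand is a union of classes and `𝓔c-↾`
  -- applies to both inclusions.
  𝓔c-split⁺ : s ∈𝓔c G → (_∣₁ {X} {Y} s ∈𝓔c (G ↾₁)) × (_∣₂ {X} {Y} s ∈𝓔c (G ↾₂))
  𝓔c-split⁺ c =
      𝓔c-↾ {X} {X ⊍ Y} (ι₁ {X} {Y}) s G (λ { (inj₁ p) → p })
        (λ {_} {z} p → closed₁ z (proj₁ split p)) c
    , 𝓔c-↾ {Y} {X ⊍ Y} (ι₂ {X} {Y}) s G (λ { (inj₂ p) → p })
        (λ {_} {z} p → closed₂ z (proj₁ split p)) c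
    where
    closed₁ : ∀ {x} z → Pointwise (𝓔._∼_ (_∣₁ {X} {Y} s)) (𝓔._∼_ (_∣₂ {X} {Y} s)) (inj₁ x) z →
              ∃ λ y → FiniteSet._≈_ (X ⊍ Y) z (inj₁ y)
    closed₁ (inj₁ z) _ = z , FiniteSet.refl (X ⊍ Y)
    closed₂ : ∀ {x} z → Pointwise (𝓔._∼_ (_∣₁ {X} {Y} s)) (𝓔._∼_ (_∣₂ {X} {Y} s)) (inj₂ x) z →
              ∃ λ y → FiniteSet._≈_ (X ⊍ Y) z (inj₂ y)
    closed₂ (inj₂ z) _ = z , FiniteSet.refl (X ⊍ Y)

  𝓔c-split⁻ : (_∣₁ {X} {Y} s ∈𝓔c (G ↾₁)) → (_∣₂ {X} {Y} s ∈𝓔c (G ↾₂)) → s ∈𝓔c G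
  𝓔c-split⁻ c d = walk⇒𝓔c s G λ p → join (proj₁ split p)
    where
    join : Pointwise (𝓔._∼_ (_∣₁ {X} {Y} s)) (𝓔._∼_ (_∣₂ {X} {Y} s)) ⇒ Walk (G ∣ᴳ s)
    join (inj₁ p) = Walk-map {X} {X ⊍ Y} {(G ↾₁) ∣ᴳ (_∣₁ {X} {Y} s)} {G ∣ᴳ s} (ι₁ {X} {Y}) id
      (𝓔c⇒walk (_∣₁ {X} {Y} s) (G ↾₁) c p)
    join (inj₂ p) = Walk-map {Y} {X ⊍ Y} {(G ↾₂) ∣ᴳ (_∣₂ {X} {Y} s)} {G ∣ᴳ s} (ι₂ {X} {Y}) id
      (𝓔c⇒walk (_∣₂ {X} {Y} s) (G ↾₂) d p)

  /ᴳ-↾ι₁ : relabel {(X ⊍ Y) / s} {(X / _∣₁ {X} {Y} s) ⊍ (Y / _∣₂ {X} {Y} s)} (/-⊍ {X} {Y} s split) (G /ᴳ s) ↾₁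
             ≈ᴳ (G ↾₁) /ᴳ (_∣₁ {X} {Y} s)
  /ᴳ-↾ι₁ =
      (λ (n , x , y , p , q , a) → into n (proj₁ split p) (proj₁ split q) a)
    , (λ (n , x , y , p , q , a) → n , inj₁ x , inj₁ y , p , q , a)
    where
    into : ∀ {x y u v} → ¬ (inj₁ x S.∼ inj₁ y) →
      Pointwise (𝓔._∼_ (_∣₁ {X} {Y} s)) (𝓔._∼_ (_∣₂ {X} {Y} s)) (inj₁ x) u →
      Pointwise (𝓔._∼_ (_∣₁ {X} {Y} s)) (𝓔._∼_ (_∣₂ {X} {Y} s)) (inj₁ y) v →
      Graph.Adj G u v → Graph.Adj ((G ↾₁) /ᴳ (_∣₁ {X} {Y} s)) x y
    into n (inj₁ p) (inj₁ q) a = n , _ , _ , p , q , a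

  /ᴳ-↾ι₂ : relabel {(X ⊍ Y) / s} {(X / _∣₁ {X} {Y} s) ⊍ (Y / _∣₂ {X} {Y} s)} (/-⊍ {X} {Y} s split) (G /ᴳ s) ↾₂
             ≈ᴳ (G ↾₂) /ᴳ (_∣₂ {X} {Y} s)
  /ᴳ-↾ι₂ =
      (λ (n , x , y , p , q , a) → into n (proj₁ split p) (proj₁ split q) a)
    , (λ (n , x , y , p , q , a) → n , inj₂ x , inj₂ y , p , q , a)
    where
    into : ∀ {x y u v} → ¬ (inj₂ x S.∼ inj₂ y) →
      Pointwise (𝓔._∼_ (_∣₁ {X} {Y} s)) (𝓔._∼_ (_∣₂ {X} {Y} s)) (inj₂ x) u →
      Pointwise (𝓔._∼_ (_∣₁ {X} {Y} s)) (𝓔._∼_ (_∣₂ {X} {Y} s)) (inj₂ y) v →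
      Graph.Adj G u v → Graph.Adj ((G ↾₂) /ᴳ (_∣₂ {X} {Y} s)) x y
    into n (inj₂ p) (inj₂ q) a = n , _ , _ , p , q , a

  -- `G` may have edges between `X` and `Y`; extraction deletes them, since a split `s` relates no
  -- element of `X` to one of `Y`.
  ∣ᴳ-split : G ∣ᴳ s ≈ᴳ (G ↾₁) ∣ᴳ (_∣₁ {X} {Y} s) ⊍ᴳ (G ↾₂) ∣ᴳ (_∣₂ {X} {Y} s)
  ∣ᴳ-split =
      (λ (a , p) → apart a (proj₁ split p))
    , (λ { (inj₁ e) → e ; (inj₂ e) → e })
    where
    apart : ∀ {x y} → Graph.Adj G x y → Pointwise (𝓔._∼_ (_∣₁ {X} {Y} s)) (𝓔._∼_ (_∣₂ {X} {Y} s)) x y →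
            Graph.Adj ((G ↾₁) ∣ᴳ (_∣₁ {X} {Y} s) ⊍ᴳ (G ↾₂) ∣ᴳ (_∣₂ {X} {Y} s)) x y
    apart a (inj₁ p) = inj₁ (a , p)
    apart a (inj₂ p) = inj₂ (a , p)

module _ (G : Graph X) (H : Graph Y) where

  ⊍ᴳ-↾ι₁ : (G ⊍ᴳ H) ↾₁ ≈ᴳ G
  ⊍ᴳ-↾ι₁ = (λ { (inj₁ a) → a }) , inj₁

  ⊍ᴳ-↾ι₂ : (G ⊍ᴳ H) ↾₂ ≈ᴳ H
  ⊍ᴳ-↾ι₂ = (λ { (inj₂ a) → a }) , inj₂

  module _ (s : 𝓔 (X ⊍ Y)) where
    private module S = 𝓔 s

    -- No edge of a disjoint union leaves its summand, hence no walk does, and a connected class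
    -- cannot meet both.
    𝓔c-⊍ᴳ⇒Splits : s ∈𝓔c G ⊍ᴳ H → Splits {X} {Y} s
    𝓔c-⊍ᴳ⇒Splits c = (λ p → apart p (𝓔c⇒walk s (G ⊍ᴳ H) c p)) , (λ { (inj₁ p) → p ; (inj₂ p) → p })
      where
      apart : ∀ {x y} → x S.∼ y → Walk ((G ⊍ᴳ H) ∣ᴳ s) x y → Pointwise (𝓔._∼_ (_∣₁ {X} {Y} s)) (𝓔._∼_ (_∣₂ {X} {Y} s)) x y
      apart {inj₁ _} {inj₁ _} p _ = inj₁ p
      apart {inj₂ _} {inj₂ _} p _ = inj₂ p
      -- After the first edge a shorter walk would still have to change summand; the recursive call
      -- lands in an empty type.
      apart {inj₁ _} {inj₂ _} p (step (inj₁ _ , q) w) with apart (S.∼-trans (S.∼-sym q) p) w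
      ... | ()
      apart {inj₂ _} {inj₁ _} p (step (inj₂ _ , q) w) with apart (S.∼-trans (S.∼-sym q) p) w
      ... | ()

    module _ (split : Splits {X} {Y} s) where

      𝓔c-⊍ᴳ⁺ : s ∈𝓔c G ⊍ᴳ H → (_∣₁ {X} {Y} s ∈𝓔c G) × (_∣₂ {X} {Y} s ∈𝓔c H)
      𝓔c-⊍ᴳ⁺ c = let c₁ , c₂ = 𝓔c-split⁺ s split (G ⊍ᴳ H) c
        in 𝓔c-cong (_∣₁ {X} {Y} s) {(G ⊍ᴳ H) ↾₁} {G} ⊍ᴳ-↾ι₁ c₁
         , 𝓔c-cong (_∣₂ {X} {Y} s) {(G ⊍ᴳ H) ↾₂} {H} ⊍ᴳ-↾ι₂ c₂

      𝓔c-⊍ᴳ⁻ : _∣₁ {X} {Y} s ∈𝓔c G → _∣₂ {X} {Y} s ∈𝓔c H → s ∈𝓔c G ⊍ᴳ H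
      𝓔c-⊍ᴳ⁻ c d = 𝓔c-split⁻ s split (G ⊍ᴳ H)
        (𝓔c-cong (_∣₁ {X} {Y} s) {G} {(G ⊍ᴳ H) ↾₁} (inj₁ , λ { (inj₁ a) → a }) c)
        (𝓔c-cong (_∣₂ {X} {Y} s) {H} {(G ⊍ᴳ H) ↾₂} (inj₂ , λ { (inj₂ a) → a }) d)

      ⊍ᴳ-/ᴳ : relabel {(X ⊍ Y) / s} {(X / _∣₁ {X} {Y} s) ⊍ (Y / _∣₂ {X} {Y} s)} (/-⊍ {X} {Y} s split) ((G ⊍ᴳ H) /ᴳ s)
                ≈ᴳ (G /ᴳ (_∣₁ {X} {Y} s)) ⊍ᴳ (H /ᴳ (_∣₂ {X} {Y} s))
      ⊍ᴳ-/ᴳ =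
          (λ (n , x , y , p , q , a) → apart n (proj₁ split p) (proj₁ split q) a)
        , (λ { (inj₁ (n , x , y , p , q , a)) → n , inj₁ x , inj₁ y , p , q , inj₁ a
             ; (inj₂ (n , x , y , p , q , a)) → n , inj₂ x , inj₂ y , p , q , inj₂ a })
        where
        apart : ∀ {x y u v} → ¬ (x S.∼ y) →
          Pointwise (𝓔._∼_ (_∣₁ {X} {Y} s)) (𝓔._∼_ (_∣₂ {X} {Y} s)) x u →
          Pointwise (𝓔._∼_ (_∣₁ {X} {Y} s)) (𝓔._∼_ (_∣₂ {X} {Y} s)) y v →
          Graph.Adj (G ⊍ᴳ H) u v → Graph.Adj ((G /ᴳ (_∣₁ {X} {Y} s)) ⊍ᴳ (H /ᴳ (_∣₂ {X} {Y} s))) x y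
        apart n (inj₁ p) (inj₁ q) (inj₁ a) = inj₁ (n , _ , _ , p , q , a)
        apart n (inj₂ p) (inj₂ q) (inj₂ a) = inj₂ (n , _ , _ , p , q , a)

      ⊍ᴳ-∣ᴳ : (G ⊍ᴳ H) ∣ᴳ s ≈ᴳ G ∣ᴳ (_∣₁ {X} {Y} s) ⊍ᴳ H ∣ᴳ (_∣₂ {X} {Y} s)
      ⊍ᴳ-∣ᴳ =
          (λ { (inj₁ a , p) → inj₁ (a , p) ; (inj₂ a , p) → inj₂ (a , p) })
        , (λ { (inj₁ (a , p)) → inj₁ a , p ; (inj₂ (a , p)) → inj₂ a , p })

-- Edgeless graphs

Edgeless : Graph X → Set
Edgeless G = ∀ x y → ¬ Graph.Adj G x y

edgeless? : (G : Graph X) → Dec (Edgeless G)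
edgeless? {X} G = ∀? X (λ x≈x′ n y a → n y (proj₂ adj-resp (sym x≈x′) a))
  (λ x → ∀? X (λ y≈y′ n a → n (proj₁ adj-resp (sym y≈y′) a)) (λ y → ¬? (adj? x y)))
  where open FiniteSet X
        open Graph G

edgeless-∣ᴳ : {s : 𝓔 X} (G : Graph X) → s ≈ᴱ discrete X → Edgeless (G ∣ᴳ s)
edgeless-∣ᴳ G (s⇒≈ , _) x y (a , p) = Graph.adj-irrefl G (s⇒≈ p) a

edgeless-∣ᴳ⇒discrete : {s : 𝓔 X} (G : Graph X) → s ∈𝓔c G → Edgeless (G ∣ᴳ s) → s ≈ᴱ discrete X
edgeless-∣ᴳ⇒discrete {X} {s} G c e =
    (λ p → Walk⇒𝓔 (discrete X) {G ∣ᴳ s} (λ {x} {y} a → contradiction a (e x y)) (𝓔c⇒walk s G c p))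
  , 𝓔.≈⇒∼ s

/ᴳ-discrete : {s : 𝓔 X} (G : Graph X) (s≈ : s ≈ᴱ discrete X) →
  relabel {X / s} {X} (/-discrete {s = s} s≈) (G /ᴳ s) ≈ᴳ G
/ᴳ-discrete {X} {s} G (s⇒≈ , _) =
    (λ (n , x , y , p , q , a) → proj₁ adj-resp (sym (s⇒≈ q)) (proj₂ adj-resp (sym (s⇒≈ p)) a))
  , (λ {x} {y} a → (λ p → adj-irrefl (s⇒≈ p) a) , x , y , ∼-refl , ∼-refl , a)
  where open FiniteSet X
        open Graph G
        open 𝓔 s

-- Connected components

module _ (G : Graph X) where
  open FiniteSet X
  open Graph G

  private
    module _ (s : 𝓔 X) (v w : Carrier) where
      open 𝓔 s

      redirect : Carrier → Carrier
      redirect x = if does (x ∼? v) then w else x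

      redirect-∼ : ∀ {x y} → x ∼ y → redirect x ∼ redirect y
      redirect-∼ {x} {y} x∼y with x ∼? v | y ∼? v
      ... | yes _   | yes _   = ∼-refl
      ... | no  _   | no  _   = x∼y
      ... | yes x∼v | no  y≁v = contradiction (∼-trans (∼-sym x∼y) x∼v) y≁v
      ... | no  x≁v | yes y∼v = contradiction (∼-trans x∼y y∼v) x≁v

      -- Pulling s back along redirect joins the classes of v and w, and
      -- yields an equivalence without case distinctions.
      merge : 𝓔 X
      merge = record
        { _∼_ = λ x y → redirect x ∼ redirect y
        ; isDecEquivalence = record
          { isEquivalence = record { refl = ∼-refl ; sym = ∼-sym ; trans = ∼-trans }
          ; _≟_ = λ x y → redirect x ∼? redirect y
          }
        ; ≈⇒∼ = λ p → redirect-∼ (≈⇒∼ p)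
        }

      -- Both sides are `w`: `redirect` sends `v` to `w`, and it keeps `w` whether or not `w` lies
      -- in the class of `v`.
      merge-∼ : redirect v ∼ redirect w
      merge-∼ with v ∼? v | w ∼? v
      ... | yes _   | yes _ = ∼-refl
      ... | yes _   | no  _ = ∼-refl
      ... | no  v≁v | _     = contradiction ∼-refl v≁v

      redirect-walk : _∼_ ⇒ Walk G → Adj v w → ∀ x → Walk G x (redirect x)
      redirect-walk h a x with x ∼? v
      ... | yes x∼v = _++ʷ_ G (h x∼v) (step a (stop refl))
      ... | no  _   = stop refl

    reverse-walk : ∀ {x y} → Walk G x y → Walk G y x
    reverse-walk (stop p)   = stop (sym p)
    reverse-walk (step a w) = _++ʷ_ G (reverse-walk w) (step (adj-sym a) (stop refl))

    -- As in union-find: start from singletons and merge two classes for each adjacent pair.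
    -- Decidability is thereby built into the relation.
    collapse : List (Carrier × Carrier) → 𝓔 X
    collapse []             = discrete X
    collapse ((v , w) ∷ es) with adj? v w
    ... | yes _ = merge (collapse es) v w
    ... | no  _ = collapse es

    collapse⇒walk : ∀ es → 𝓔._∼_ (collapse es) ⇒ Walk G
    collapse⇒walk []             p = stop p
    collapse⇒walk ((v , w) ∷ es) {x} {y} p with adj? v w
    ... | no  _ = collapse⇒walk es p
    -- From `x` to its redirected vertex, on by the induction hypothesis, and back from the
    -- redirected vertex of `y` to `y`.
    ... | yes a = _++ʷ_ G (walk x) (_++ʷ_ G (collapse⇒walk es p) (reverse-walk (walk y)))
      where walk = redirect-walk (collapse es) v w (collapse⇒walk es) a

    -- The pair that represents `x` and `y` is joined at its turn, and later merges only coarsen the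
    -- relation.
    collapse⁺ : ∀ {es x y} → Any (λ (v , w) → x ≈ v × y ≈ w) es → Adj x y → 𝓔._∼_ (collapse es) x y
    collapse⁺ {(v , w) ∷ es} i b with adj? v w | i
    ... | yes _ | here (p , q) = ∼-trans (≈⇒∼ p) (∼-trans (merge-∼ (collapse es) v w) (≈⇒∼ (sym q)))
      where open 𝓔 (merge (collapse es) v w)
    ... | yes _ | there j      = redirect-∼ (collapse es) v w (collapse⁺ j b)
    ... | no ¬a | here (p , q) = contradiction (proj₁ adj-resp q (proj₂ adj-resp p b)) ¬a
    ... | no  _ | there j      = collapse⁺ j b

  components : 𝓔 X
  components = collapse (cartesianProduct elements elements)

  components⇒walk : 𝓔._∼_ components ⇒ Walk G
  components⇒walk = collapse⇒walk (cartesianProduct elements elements)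

  -- Every vertex is `≈` to a listed one, so pairs of listed elements represent all edges.
  adj⇒components : Adj ⇒ 𝓔._∼_ components
  adj⇒components {x} {y} = collapse⁺ (Any.cartesianProduct⁺ (complete x) (complete y))

  ≈components⇒𝓔c : {s : 𝓔 X} → components ≈ᴱ s → s ∈𝓔c G
  ≈components⇒𝓔c {s} (c⇒s , s⇒c) = walk⇒𝓔c s G λ p →
    Walk-mono {G = G} {G ∣ᴳ s} (λ a → a , c⇒s (adj⇒components a)) (components⇒walk (s⇒c p))

  ≈components⇒edgeless : {s : 𝓔 X} → components ≈ᴱ s → Edgeless (G /ᴳ s)
  ≈components⇒edgeless {s} (c⇒s , _) x y (n , _ , _ , p , q , a) =
    n (∼-trans p (∼-trans (c⇒s (adj⇒components a)) (∼-sym q)))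
    where open 𝓔 s

  -- If no edge survives contraction, every edge of `G` lies in a class of `s`, so components lie in
  -- classes; connectedness of the classes gives the converse.
  edgeless-/ᴳ⇒≈components : {s : 𝓔 X} → s ∈𝓔c G → Edgeless (G /ᴳ s) → components ≈ᴱ s
  edgeless-/ᴳ⇒≈components {s} c e =
      (λ p → Walk⇒𝓔 s {G} adj⇒s (components⇒walk p))
    , (λ p → Walk⇒𝓔 components {G ∣ᴳ s} (λ (a , _) → adj⇒components a) (𝓔c⇒walk s G c p))
    where
    open 𝓔 s
    adj⇒s : Adj ⇒ _∼_
    -- An edge between inequivalent vertices would survive in the quotient; decidability of `s`
    -- removes the double negation.
    adj⇒s {x} {y} a = decidable-stable (x ∼? y) λ n → e x y (n , x , y , ∼-refl , ∼-refl , a)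

  ≈components⇒∣ᴳ : {s : 𝓔 X} → components ≈ᴱ s → G ∣ᴳ s ≈ᴳ G
  ≈components⇒∣ᴳ (c⇒s , _) = proj₁ , (λ a → a , c⇒s (adj⇒components a))

-- Linear algebra: tensors, scalars and finite sums

module _ {c ℓ₁ ℓ₂ : Level} (K : HeytingField c ℓ₁ ℓ₂) where
  open OverField K
  open LeftModule using (Carrierᴹ)
  open _⊸_ using (⟦⟧-cong; 0ᴹ-homo)
  private
    module 𝕂 = CommutativeRing 𝕂

    variable
      m ℓm n ℓn : Level

  tensorʳ : {M : VectorSpace m ℓm} {N : VectorSpace n ℓn} → Carrierᴹ N → M ⊸ M ⊗ N
  tensorʳ {M = M} {N} y = linear (λ x → _⊗ᵗ_ {M = M} {N} x y)
    (λ x≈x′ → rel (⊗-cong x≈x′ (LeftModule.≈ᴹ-refl N)))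
    (λ x x′ → rel (⊗-+ˡ x x′ y)) (λ k x → rel (⊗-*ˡ k x y))

  module _ (M : VectorSpace m ℓm) where
    open LeftModule M

    scale-1 : ∀ {k x} → k 𝕂.≈ 𝕂.1# → (k *ₗ x) ≈ᴹ x
    scale-1 k≈1 = ≈ᴹ-trans (*ₗ-cong k≈1 ≈ᴹ-refl) (*ₗ-identityˡ _)

    scale-0 : ∀ {k x} → k 𝕂.≈ 𝕂.0# → (k *ₗ x) ≈ᴹ 0ᴹ
    scale-0 k≈0 = ≈ᴹ-trans (*ₗ-cong k≈0 ≈ᴹ-refl) (*ₗ-zeroˡ _)

  module _ {M : VectorSpace m ℓm} {N : VectorSpace n ℓn} where
    open LeftModule N

    sumₗ-0 : (F : 𝓔 X → M ⊸ N) (x : Carrierᴹ M) {ss : List (𝓔 X)} →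
      All (λ s → ⟦ F s ⟧ x ≈ᴹ 0ᴹ) ss → ⟦ sumₗ (map F ss) ⟧ x ≈ᴹ 0ᴹ
    sumₗ-0 F x []       = ≈ᴹ-refl
    sumₗ-0 F x (z ∷ zs) = ≈ᴹ-trans (+ᴹ-cong z (sumₗ-0 F x zs)) (+ᴹ-identityˡ 0ᴹ)

    -- The list represents `r`, and by uniqueness only once, so the sum has a single surviving term.
    -- This evaluates the sum in the left counit axiom.
    sumₗ-single : (F : 𝓔 X → M ⊸ N) (x : Carrierᴹ M) {y : Carrierᴹ N} (r : 𝓔 X) →
      (∀ s → r ≈ᴱ s → ⟦ F s ⟧ x ≈ᴹ y) → (∀ s → ¬ (r ≈ᴱ s) → ⟦ F s ⟧ x ≈ᴹ 0ᴹ) →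
      ∀ {ss} → Any (r ≈ᴱ_) ss → Unique (𝓔-decSetoid X) ss → ⟦ sumₗ (map F ss) ⟧ x ≈ᴹ y
    sumₗ-single {X = X} F x r one none {s ∷ _} (here r≈s) (s≉ ∷ _) =
      ≈ᴹ-trans (+ᴹ-cong (one s r≈s) (sumₗ-0 F x (All.map
        (λ {t} s≉t → none t λ r≈t → s≉t (E.trans {s} {r} {t} (E.sym {r} {s} r≈s) r≈t)) s≉)))
      (+ᴹ-identityʳ _)
      where module E = DecSetoid (𝓔-decSetoid X)
    sumₗ-single {X = X} F x r one none {s ∷ _} (there i) (s≉ ∷ u) =
      ≈ᴹ-trans (+ᴹ-cong (none s λ r≈s → All.lookupWith
          (λ {t} s≉t r≈t → s≉t (E.trans {s} {r} {t} (E.sym {r} {s} r≈s) r≈t)) s≉ i)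
        (sumₗ-single F x r one none i u))
      (+ᴹ-identityˡ _)
      where module E = DecSetoid (𝓔-decSetoid X)

  -- The axioms are equations between linear maps, so they are checked on
  -- the images ⌜ G ⌝ of the graphs, knowing only the values of the
  -- structure maps there.
  module SpannedByGraphs {p ℓp : Level} (P : Species p ℓp)
    (⌜_⌝ : ∀ {X} → Graph X → Carrierᴹ (P [ X ]))
    (⌜⌝-cong : ∀ {X} (G H : Graph X) → G ≈ᴳ H → LeftModule._≈ᴹ_ (P [ X ]) ⌜ G ⌝ ⌜ H ⌝)
    (⌜⌝-ext : ∀ {n ℓn X} {N : VectorSpace n ℓn} {f g : P [ X ] ⊸ N} →
      (∀ G → LeftModule._≈ᴹ_ N (⟦ f ⟧ ⌜ G ⌝) (⟦ g ⟧ ⌜ G ⌝)) → f ≐ g)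
    (act-⌜⌝ : ∀ {X Y} (σ : X ≃ Y) (G : Graph X) →
      LeftModule._≈ᴹ_ (P [ Y ]) (⟦ Species.act P {X} {Y} σ ⟧ ⌜ G ⌝) ⌜ relabel {X} {Y} σ G ⌝)
    (δ : Coproducts P)
    (δ-connected : ∀ {X} (s : 𝓔 X) (G : Graph X) → s ∈𝓔c G →
      LeftModule._≈ᴹ_ (P [ X / s ] ⊗ P [ X ]) (⟦ δ s ⟧ ⌜ G ⌝) (gen (⌜ G /ᴳ s ⌝ , ⌜ G ∣ᴳ s ⌝)))
    (δ-disconnected : ∀ {X} (s : 𝓔 X) (G : Graph X) → ¬ s ∈𝓔c G →
      LeftModule._≈ᴹ_ (P [ X / s ] ⊗ P [ X ]) (⟦ δ s ⟧ ⌜ G ⌝) 𝟘)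
    where
    open Species P using (act)

    -- One variable at a time: fix an arbitrary second factor to reduce the first to a graph, then
    -- fix that graph to reduce the second.
    ⌜⌝⊗-ext : {N : VectorSpace n ℓn} {f g : P [ X ] ⊗ P [ Y ] ⊸ N} →
      (∀ G H → LeftModule._≈ᴹ_ N (⟦ f ⟧ (gen (⌜ G ⌝ , ⌜ H ⌝))) (⟦ g ⟧ (gen (⌜ G ⌝ , ⌜ H ⌝)))) → f ≐ g
    ⌜⌝⊗-ext {X = X} {Y} {N = N} {f} {g} e = gen-ext (TensorRel (P [ X ]) (P [ Y ])) λ (x , y) →
      at (⌜⌝-ext {f = f ∘ₗ tensorʳ y} {g ∘ₗ tensorʳ y} λ G →
        at (⌜⌝-ext {f = f ∘ₗ tensorˡ ⌜ G ⌝} {g ∘ₗ tensorˡ ⌜ G ⌝} (e G)) y) x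

    act-⌜⌝-≈ : ∀ {X Y} (σ : X ≃ Y) (G : Graph X) (H : Graph Y) → relabel {X} {Y} σ G ≈ᴳ H →
      LeftModule._≈ᴹ_ (P [ Y ]) (⟦ act {X} {Y} σ ⟧ ⌜ G ⌝) ⌜ H ⌝
    act-⌜⌝-≈ {X} {Y} σ G H e =
      LeftModule.≈ᴹ-trans (P [ Y ]) (act-⌜⌝ {X} {Y} σ G) (⌜⌝-cong (relabel {X} {Y} σ G) H e)

    -- Linear maps applied to values of `δ`

    module _ (N : VectorSpace n ℓn) where
      open LeftModule N

      -- Connectedness is decidable, so any equation about `F` after `δ s` reduces to a pure tensor
      -- in one case and to zero in the other.
      δ-elim : ∀ {X} (s : 𝓔 X) (G : Graph X) (F : P [ X / s ] ⊗ P [ X ] ⊸ N) {y : Carrierᴹ N} →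
        (s ∈𝓔c G → ⟦ F ⟧ (gen (⌜ G /ᴳ s ⌝ , ⌜ G ∣ᴳ s ⌝)) ≈ᴹ y) →
        (¬ s ∈𝓔c G → 0ᴹ ≈ᴹ y) →
        ⟦ F ⟧ (⟦ δ s ⟧ ⌜ G ⌝) ≈ᴹ y
      δ-elim s G F connected disconnected = by (∈𝓔c? s G)
        where
        by : Dec (s ∈𝓔c G) → ⟦ F ⟧ (⟦ δ s ⟧ ⌜ G ⌝) ≈ᴹ _
        by (yes c) = ≈ᴹ-trans (⟦⟧-cong F (δ-connected s G c)) (connected c)
        by (no ¬c) = ≈ᴹ-trans (⟦⟧-cong F (δ-disconnected s G ¬c)) (≈ᴹ-trans (0ᴹ-homo F) (disconnected ¬c))

      δ-agree : ∀ {X Y} (r : 𝓔 X) (G : Graph X) (s : 𝓔 Y) (H : Graph Y)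
        (F : P [ X / r ] ⊗ P [ X ] ⊸ N) (F′ : P [ Y / s ] ⊗ P [ Y ] ⊸ N) →
        (r ∈𝓔c G → s ∈𝓔c H) → (s ∈𝓔c H → r ∈𝓔c G) →
        ⟦ F ⟧ (gen (⌜ G /ᴳ r ⌝ , ⌜ G ∣ᴳ r ⌝)) ≈ᴹ ⟦ F′ ⟧ (gen (⌜ H /ᴳ s ⌝ , ⌜ H ∣ᴳ s ⌝)) →
        ⟦ F ⟧ (⟦ δ r ⟧ ⌜ G ⌝) ≈ᴹ ⟦ F′ ⟧ (⟦ δ s ⟧ ⌜ H ⌝)
      δ-agree r G s H F F′ to from e = δ-elim r G F
        (λ c → ≈ᴹ-trans e (≈ᴹ-sym (⟦⟧-cong F′ (δ-connected s H (to c)))))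
        (λ ¬c → ≈ᴹ-sym (≈ᴹ-trans (⟦⟧-cong F′ (δ-disconnected s H (¬c ∘ from))) (0ᴹ-homo F′)))

      -- The right-hand side is linear in each of the two values of `δ` separately, so they are
      -- eliminated in turn; it vanishes as soon as one of them does. Both compatibility squares
      -- rest on this comparison.
      δ⊗δ-agree : ∀ {X Y Z} (r : 𝓔 Z) (Γ : Graph Z) (s : 𝓔 X) (G : Graph X) (t : 𝓔 Y) (H : Graph Y)
        (F : P [ Z / r ] ⊗ P [ Z ] ⊸ N) (F′ : (P [ X / s ] ⊗ P [ X ]) ⊗ (P [ Y / t ] ⊗ P [ Y ]) ⊸ N) →
        (r ∈𝓔c Γ → s ∈𝓔c G × t ∈𝓔c H) → (s ∈𝓔c G → t ∈𝓔c H → r ∈𝓔c Γ) →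
        ⟦ F ⟧ (gen (⌜ Γ /ᴳ r ⌝ , ⌜ Γ ∣ᴳ r ⌝)) ≈ᴹ
          ⟦ F′ ⟧ (gen (gen (⌜ G /ᴳ s ⌝ , ⌜ G ∣ᴳ s ⌝) , gen (⌜ H /ᴳ t ⌝ , ⌜ H ∣ᴳ t ⌝))) →
        ⟦ F ⟧ (⟦ δ r ⟧ ⌜ Γ ⌝) ≈ᴹ ⟦ F′ ⟧ (gen (⟦ δ s ⟧ ⌜ G ⌝ , ⟦ δ t ⟧ ⌜ H ⌝))
      δ⊗δ-agree r Γ s G t H F F′ to from e = ≈ᴹ-sym
        (δ-elim s G (F′ ∘ₗ tensorʳ (⟦ δ t ⟧ ⌜ H ⌝))
          (λ c → δ-elim t H (F′ ∘ₗ tensorˡ (gen (⌜ G /ᴳ s ⌝ , ⌜ G ∣ᴳ s ⌝)))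
            (λ d → ≈ᴹ-sym (≈ᴹ-trans (⟦⟧-cong F (δ-connected r Γ (from c d))) e))
            (λ ¬d → vanish λ (_ , d) → ¬d d))
          (λ ¬c → vanish λ (c , _) → ¬c c))
        where
        vanish : ¬ (s ∈𝓔c G × t ∈𝓔c H) → 0ᴹ ≈ᴹ ⟦ F ⟧ (⟦ δ r ⟧ ⌜ Γ ⌝)
        vanish ¬cd = ≈ᴹ-sym (≈ᴹ-trans (⟦⟧-cong F (δ-disconnected r Γ (¬cd ∘ to))) (0ᴹ-homo F))

    -- The counit and the contraction-extraction axioms

    module _ (ϵ : ∀ X → P [ X ] ⊸ 𝕂ᴹ)
      (ϵ-1 : ∀ {X} (G : Graph X) → Edgeless G → ⟦ ϵ X ⟧ ⌜ G ⌝ 𝕂.≈ 𝕂.1#)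
      (ϵ-0 : ∀ {X} (G : Graph X) → ¬ Edgeless G → ⟦ ϵ X ⟧ ⌜ G ⌝ 𝕂.≈ 𝕂.0#)
      where

      ϵ-agree : (G : Graph X) (H : Graph Y) → (Edgeless G → Edgeless H) → (Edgeless H → Edgeless G) →
        ⟦ ϵ X ⟧ ⌜ G ⌝ 𝕂.≈ ⟦ ϵ Y ⟧ ⌜ H ⌝
      ϵ-agree G H to from with edgeless? G
      ... | yes e = 𝕂.trans (ϵ-1 G e) (𝕂.sym (ϵ-1 H (to e)))
      ... | no ¬e = 𝕂.trans (ϵ-0 G ¬e) (𝕂.sym (ϵ-0 H (¬e ∘ from)))

      -- Either the outer `δ r` is zero or the inner `δ s` is. This supplies the vanishing cases of
      -- coassociativity.
      δδ-disconnected : ∀ {X} (r s : 𝓔 X) (G : Graph X) → (r ∈𝓔c G → ¬ s ∈𝓔c G ∣ᴳ r) →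
        LeftModule._≈ᴹ_ (P [ X / r ] ⊗ (P [ X / s ] ⊗ P [ X ])) (⟦ idₗ ⊗₁ δ s ⟧ (⟦ δ r ⟧ ⌜ G ⌝)) 𝟘
      δδ-disconnected {X} r s G ¬both = δ-elim (P [ X / r ] ⊗ (P [ X / s ] ⊗ P [ X ])) r G
        (_⊗₁_ {M = P [ X / r ]} {P [ X ]} {P [ X / r ]} {P [ X / s ] ⊗ P [ X ]} idₗ (δ s))
        (λ c → ≈-trans (rel (⊗-cong (LeftModule.≈ᴹ-refl (P [ X / r ])) (δ-disconnected s (G ∣ᴳ r) (¬both c))))
          (0ᴹ-homo (tensorˡ ⌜ G /ᴳ r ⌝)))
        (λ _ → ≈-refl)

      module _ {X : FiniteSet} {r s : 𝓔 X} (r≤s : r ≤ᴱ s) (G : Graph X) where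
        private
          r/s : 𝓔 (X / s)
          r/s = _over_ {X} r {s} r≤s

          contract : P [ (X / s) / r/s ] ⊗ P [ X / s ] ⊸ P [ X / r ] ⊗ P [ X / s ]
          contract = act {(X / s) / r/s} {X / r} (/-/ {X} {r} {s} r≤s) ⊗₁ idₗ

          δ⊗id : P [ X / s ] ⊗ P [ X ] ⊸ P [ X / r ] ⊗ (P [ X / s ] ⊗ P [ X ])
          δ⊗id = assoc⊗ ∘ₗ ((contract ∘ₗ δ r/s) ⊗₁ idₗ)

          id⊗δ : P [ X / r ] ⊗ P [ X ] ⊸ P [ X / r ] ⊗ (P [ X / s ] ⊗ P [ X ])
          id⊗δ = idₗ ⊗₁ δ s

        δ-coassoc-⌜⌝ : LeftModule._≈ᴹ_ (P [ X / r ] ⊗ (P [ X / s ] ⊗ P [ X ]))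
          (⟦ δ⊗id ⟧ (⟦ δ s ⟧ ⌜ G ⌝)) (⟦ id⊗δ ⟧ (⟦ δ r ⟧ ⌜ G ⌝))
        δ-coassoc-⌜⌝ = δ-elim (P [ X / r ] ⊗ (P [ X / s ] ⊗ P [ X ])) s G δ⊗id
          (λ c → δ-elim (P [ X / r ] ⊗ (P [ X / s ] ⊗ P [ X ])) r/s (G /ᴳ s)
            -- With `⌜ G ∣ᴳ s ⌝` held fixed as last factor, the left-hand side is a linear map of
            -- the value of `δ r/s` alone.
            (assoc⊗ {M = P [ X / r ]} {P [ X / s ]} {P [ X ]} ∘ₗ tensorʳ {M = P [ X / r ] ⊗ P [ X / s ]} {P [ X ]} ⌜ G ∣ᴳ s ⌝ ∘ₗ contract)
            (λ d → ≈-sym (δ-elim (P [ X / r ] ⊗ (P [ X / s ] ⊗ P [ X ])) r G id⊗δ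
              (λ _ → ≈-trans
                (rel (⊗-cong (LeftModule.≈ᴹ-refl (P [ X / r ])) (δ-connected s (G ∣ᴳ r) (𝓔c-∣ᴳ⁺ {X} {r} {s} r≤s G c))))
                (≈-sym (rel (⊗-cong
                  (act-⌜⌝-≈ {(X / s) / r/s} {X / r} (/-/ {X} {r} {s} r≤s) ((G /ᴳ s) /ᴳ r/s) (G /ᴳ r) (/ᴳ-/ᴳ {X} {r} {s} r≤s G))
                  (rel (⊗-cong
                    (⌜⌝-cong ((G /ᴳ s) ∣ᴳ r/s) ((G ∣ᴳ r) /ᴳ s) (/ᴳ-∣ᴳ {X} {r} {s} r≤s G))
                    (⌜⌝-cong (G ∣ᴳ s) ((G ∣ᴳ r) ∣ᴳ s) (∣ᴳ-∣ᴳ {X} {r} {s} r≤s G))))))))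
              (λ ¬r → contradiction (𝓔c-over⁻ {X} {r} {s} r≤s G c d) ¬r)))
            (λ ¬d → ≈-sym (δδ-disconnected r s G λ r∈ _ → ¬d (𝓔c-over⁺ {X} {r} {s} r≤s G r∈))))
          (λ ¬c → ≈-sym (δδ-disconnected r s G λ _ s∈ → ¬c (𝓔c-∣ᴳ⁻ {X} {r} {s} r≤s G s∈)))

      isContractionExtraction : IsContractionExtraction P δ
      isContractionExtraction = record
        { δ-cong = λ {X} {r} {s} r≈s → ⌜⌝-ext λ G →
            δ-agree (P [ X / s ] ⊗ P [ X ]) r G s G
              (_⊗₁_ {M = P [ X / r ]} {P [ X ]} {P [ X / s ]} {P [ X ]} (act {X / r} {X / s} (/-cong {X} {r} {s} r≈s)) idₗ) idₗ
              (𝓔c-congᴱ {X} {r} {s} G r≈s) (𝓔c-congᴱ {X} {s} {r} G (proj₂ r≈s , proj₁ r≈s))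
              (rel (⊗-cong
                (act-⌜⌝-≈ {X / r} {X / s} (/-cong {X} {r} {s} r≈s) (G /ᴳ r) (G /ᴳ s) (/ᴳ-congᴱ {X} {r} {s} G r≈s))
                (⌜⌝-cong (G ∣ᴳ r) (G ∣ᴳ s) (∣ᴳ-congᴱ {X} {r} {s} G r≈s))))
        ; δ-natural = λ {X} {Y} σ s → ⌜⌝-ext λ G →
            ≈-trans (⟦⟧-cong (δ (transport {X} {Y} σ s)) (act-⌜⌝ {X} {Y} σ G))
              (δ-agree (P [ Y / transport {X} {Y} σ s ] ⊗ P [ Y ]) (transport {X} {Y} σ s) (relabel {X} {Y} σ G) s G
                idₗ (_⊗₁_ {M = P [ X / s ]} {P [ X ]} {P [ Y / transport {X} {Y} σ s ]} {P [ Y ]}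
                  (act {X / s} {Y / transport {X} {Y} σ s} (/-map {X} {Y} σ s)) (act {X} {Y} σ))
                (𝓔c-relabel⁻ {X} {Y} σ s G) (𝓔c-relabel⁺ {X} {Y} σ s G)
                (≈-sym (rel (⊗-cong
                  (act-⌜⌝-≈ {X / s} {Y / transport {X} {Y} σ s} (/-map {X} {Y} σ s) (G /ᴳ s)
                    (relabel {X} {Y} σ G /ᴳ transport {X} {Y} σ s) (relabel-/ᴳ {X} {Y} σ s G))
                  -- Extraction commutes with relabelling by definition, as both adjacencies are
                  -- read off along `from`.
                  (act-⌜⌝-≈ {X} {Y} σ (G ∣ᴳ s) (relabel {X} {Y} σ G ∣ᴳ transport {X} {Y} σ s) (id , id))))))
        ; δ-coassoc = λ {X} {r} {s} r≤s → ⌜⌝-ext (δ-coassoc-⌜⌝ {X} {r} {s} r≤s)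
        ; δ-coassoc-0 = λ {X} {r} {s} r≰s → ⌜⌝-ext λ G →
            δδ-disconnected r s G λ _ c → r≰s (𝓔c-∣ᴳ⇒≤ {X} {r} {s} G c)
        ; ϵ = ϵ
        ; ϵ-natural = λ {X} {Y} σ → ⌜⌝-ext λ G → 𝕂.trans (⟦⟧-cong (ϵ Y) (act-⌜⌝ {X} {Y} σ G))
            (ϵ-agree (relabel {X} {Y} σ G) G
              (λ e x y a → e (Inverse.to σ x) (Inverse.to σ y) (relabel⁺ {X} {Y} σ G a))
              (λ e x y a → e _ _ a))
        ; ϵ-right = λ {X} {s} s≈ → ⌜⌝-ext λ G → let open LeftModule (P [ X ]) in
            δ-elim (P [ X ]) s G (act {X / s} {X} (/-discrete {X} {s} s≈) ∘ₗ unitʳ⊗ ∘ₗ _⊗₁_ {M = P [ X / s ]} {P [ X ]} {P [ X / s ]} {𝕂ᴹ} idₗ (ϵ X))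
              (λ _ → ≈ᴹ-trans
                (⟦⟧-cong (act {X / s} {X} (/-discrete {X} {s} s≈)) (scale-1 (P [ X / s ]) (ϵ-1 (G ∣ᴳ s) (edgeless-∣ᴳ {s = s} G s≈))))
                (act-⌜⌝-≈ {X / s} {X} (/-discrete {X} {s} s≈) (G /ᴳ s) G (/ᴳ-discrete {s = s} G s≈)))
              -- The zero case cannot occur: singletons are always connected.
              (λ ¬c → contradiction (𝓔c-congᴱ {X} {discrete X} {s} G (proj₂ s≈ , proj₁ s≈) (discrete-𝓔c G)) ¬c)
        ; ϵ-right-0 = λ {X} {s} s≉ → ⌜⌝-ext λ G → let open LeftModule (P [ X / s ]) in
            δ-elim (P [ X / s ]) s G (unitʳ⊗ ∘ₗ _⊗₁_ {M = P [ X / s ]} {P [ X ]} {P [ X / s ]} {𝕂ᴹ} idₗ (ϵ X))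
              (λ c → scale-0 (P [ X / s ]) (ϵ-0 (G ∣ᴳ s) λ e → s≉ (edgeless-∣ᴳ⇒discrete {s = s} G c e)))
              (λ _ → ≈ᴹ-refl)
        ; ϵ-left = λ X → ⌜⌝-ext λ G → let open LeftModule (P [ X ]) in
            -- Only the component relation contributes: it leaves no edge after contraction, giving
            -- coefficient 1, and extraction along it keeps all of `G`.
            sumₗ-single (λ s → unitˡ⊗ ∘ₗ (ϵ (X / s) ⊗₁ idₗ) ∘ₗ δ s) ⌜ G ⌝ (components G)
              (λ s c≈s → δ-elim (P [ X ]) s G (unitˡ⊗ ∘ₗ _⊗₁_ {M = P [ X / s ]} {P [ X ]} {𝕂ᴹ} {P [ X ]} (ϵ (X / s)) idₗ)
                (λ _ → ≈ᴹ-trans (scale-1 (P [ X ]) (ϵ-1 (G /ᴳ s) (≈components⇒edgeless G {s} c≈s)))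
                  (⌜⌝-cong (G ∣ᴳ s) G (≈components⇒∣ᴳ G {s} c≈s)))
                (λ ¬c → contradiction (≈components⇒𝓔c G {s} c≈s) ¬c))
              (λ s c≉s → δ-elim (P [ X ]) s G (unitˡ⊗ ∘ₗ _⊗₁_ {M = P [ X / s ]} {P [ X ]} {𝕂ᴹ} {P [ X ]} (ϵ (X / s)) idₗ)
                (λ c → scale-0 (P [ X ]) (ϵ-0 (G /ᴳ s) λ e → c≉s (edgeless-/ᴳ⇒≈components G {s} c e)))
                (λ _ → ≈ᴹ-refl))
              (equivalences-complete X (components G)) (equivalences-unique X)
        }

    -- Compatibility with product and coproduct

    module _ (B : RawTwistedBialgebra P) where
      open RawTwistedBialgebra B

      module _
        (μ-⌜⌝ : ∀ X Y (G : Graph X) (H : Graph Y) →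
          LeftModule._≈ᴹ_ (P [ X ⊍ Y ]) (⟦ μ X Y ⟧ (gen (⌜ G ⌝ , ⌜ H ⌝))) ⌜ G ⊍ᴳ H ⌝)
        (Δ-⌜⌝ : ∀ X Y (G : Graph (X ⊍ Y)) →
          LeftModule._≈ᴹ_ (P [ X ] ⊗ P [ Y ]) (⟦ Δ X Y ⟧ ⌜ G ⌝) (gen (⌜ G ↾₁ ⌝ , ⌜ G ↾₂ ⌝)))
        (𝟏-⌜⌝ : LeftModule._≈ᴹ_ (P [ ∅ ]) 𝟏 ⌜ emptyGraph ⌝)
        (ε-⌜⌝ : ∀ G → ⟦ ε ⟧ ⌜ G ⌝ 𝕂.≈ 𝕂.1#)
        where

        module _ {X Y : FiniteSet} (r : 𝓔 (X ⊍ Y)) (s : 𝓔 X) (t : 𝓔 Y) (τ : (X ⊍ Y) / r ≃ (X / s) ⊍ (Y / t)) where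

          private
            act⊗id : P [ (X ⊍ Y) / r ] ⊗ P [ X ⊍ Y ] ⊸ P [ (X / s) ⊍ (Y / t) ] ⊗ P [ X ⊍ Y ]
            act⊗id = act {(X ⊍ Y) / r} {(X / s) ⊍ (Y / t)} τ ⊗₁ idₗ

            Δact⊗id : P [ (X ⊍ Y) / r ] ⊗ P [ X ⊍ Y ] ⊸ (P [ X / s ] ⊗ P [ Y / t ]) ⊗ P [ X ⊍ Y ]
            Δact⊗id = (Δ (X / s) (Y / t) ∘ₗ act {(X ⊍ Y) / r} {(X / s) ⊍ (Y / t)} τ) ⊗₁ idₗ

            μ⊗μ : (P [ X / s ] ⊗ P [ X ]) ⊗ (P [ Y / t ] ⊗ P [ Y ]) ⊸ P [ (X / s) ⊍ (Y / t) ] ⊗ P [ X ⊍ Y ]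
            μ⊗μ = (μ (X / s) (Y / t) ⊗₁ μ X Y) ∘ₗ interchange⊗

            id⊗μ : (P [ X / s ] ⊗ P [ X ]) ⊗ (P [ Y / t ] ⊗ P [ Y ]) ⊸ (P [ X / s ] ⊗ P [ Y / t ]) ⊗ P [ X ⊍ Y ]
            id⊗μ = (idₗ ⊗₁ μ X Y) ∘ₗ interchange⊗

          -- Here `r`, `s`, `t` and `τ` are arbitrary and the graph theory enters as hypotheses, so
          -- that only linear algebra remains; likewise in `δ-Δ-⌜⌝`.
          δ-μ-⌜⌝ : (G : Graph X) (H : Graph Y) →
            (r ∈𝓔c G ⊍ᴳ H → s ∈𝓔c G × t ∈𝓔c H) → (s ∈𝓔c G → t ∈𝓔c H → r ∈𝓔c G ⊍ᴳ H) →
            relabel {(X ⊍ Y) / r} {(X / s) ⊍ (Y / t)} τ ((G ⊍ᴳ H) /ᴳ r) ≈ᴳ (G /ᴳ s) ⊍ᴳ (H /ᴳ t) →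
            (G ⊍ᴳ H) ∣ᴳ r ≈ᴳ G ∣ᴳ s ⊍ᴳ H ∣ᴳ t →
            LeftModule._≈ᴹ_ (P [ (X / s) ⊍ (Y / t) ] ⊗ P [ X ⊍ Y ])
              (⟦ act⊗id ⟧ (⟦ δ {X ⊍ Y} r ⟧ (⟦ μ X Y ⟧ (gen (⌜ G ⌝ , ⌜ H ⌝)))))
              (⟦ μ⊗μ ⟧ (gen (⟦ δ {X} s ⟧ ⌜ G ⌝ , ⟦ δ {Y} t ⟧ ⌜ H ⌝)))
          δ-μ-⌜⌝ G H to from e e′ = ≈-trans
            (⟦⟧-cong act⊗id (⟦⟧-cong (δ {X ⊍ Y} r) (μ-⌜⌝ X Y G H)))
            (δ⊗δ-agree (P [ (X / s) ⊍ (Y / t) ] ⊗ P [ X ⊍ Y ]) {X} {Y} {X ⊍ Y} r (G ⊍ᴳ H) s G t H act⊗id μ⊗μ to from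
              (≈-trans
                (rel (⊗-cong
                  (act-⌜⌝-≈ {(X ⊍ Y) / r} {(X / s) ⊍ (Y / t)} τ ((G ⊍ᴳ H) /ᴳ r) ((G /ᴳ s) ⊍ᴳ (H /ᴳ t)) e)
                  (⌜⌝-cong ((G ⊍ᴳ H) ∣ᴳ r) (G ∣ᴳ s ⊍ᴳ H ∣ᴳ t) e′)))
                (≈-sym (rel (⊗-cong (μ-⌜⌝ (X / s) (Y / t) (G /ᴳ s) (H /ᴳ t)) (μ-⌜⌝ X Y (G ∣ᴳ s) (H ∣ᴳ t)))))))

          δ-Δ-⌜⌝ : (G : Graph (X ⊍ Y)) →
            (r ∈𝓔c G → s ∈𝓔c (G ↾₁) × t ∈𝓔c (G ↾₂)) → (s ∈𝓔c (G ↾₁) → t ∈𝓔c (G ↾₂) → r ∈𝓔c G) →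
            relabel {(X ⊍ Y) / r} {(X / s) ⊍ (Y / t)} τ (G /ᴳ r) ↾₁ ≈ᴳ (G ↾₁) /ᴳ s →
            relabel {(X ⊍ Y) / r} {(X / s) ⊍ (Y / t)} τ (G /ᴳ r) ↾₂ ≈ᴳ (G ↾₂) /ᴳ t →
            G ∣ᴳ r ≈ᴳ (G ↾₁) ∣ᴳ s ⊍ᴳ (G ↾₂) ∣ᴳ t →
            LeftModule._≈ᴹ_ ((P [ X / s ] ⊗ P [ Y / t ]) ⊗ P [ X ⊍ Y ])
              (⟦ Δact⊗id ⟧ (⟦ δ {X ⊍ Y} r ⟧ ⌜ G ⌝))
              (⟦ id⊗μ ⟧ (⟦ δ {X} s ⊗₁ δ {Y} t ⟧ (⟦ Δ X Y ⟧ ⌜ G ⌝)))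
          δ-Δ-⌜⌝ G to from e₁ e₂ e′ = ≈-trans
            (δ⊗δ-agree ((P [ X / s ] ⊗ P [ Y / t ]) ⊗ P [ X ⊍ Y ]) {X} {Y} {X ⊍ Y} r G s (G ↾₁) t (G ↾₂) Δact⊗id id⊗μ to from
              (≈-trans
                (rel (⊗-cong
                  -- `Δ` cuts the relabelled quotient in two, and each half is compared with the
                  -- quotient of the corresponding half of `G`.
                  (≈-trans (⟦⟧-cong (Δ (X / s) (Y / t)) (act-⌜⌝ {(X ⊍ Y) / r} {(X / s) ⊍ (Y / t)} τ (G /ᴳ r)))
                    (≈-trans (Δ-⌜⌝ (X / s) (Y / t) (relabel {(X ⊍ Y) / r} {(X / s) ⊍ (Y / t)} τ (G /ᴳ r)))
                      (rel (⊗-cong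
                        (⌜⌝-cong (relabel {(X ⊍ Y) / r} {(X / s) ⊍ (Y / t)} τ (G /ᴳ r) ↾₁) ((G ↾₁) /ᴳ s) e₁)
                        (⌜⌝-cong (relabel {(X ⊍ Y) / r} {(X / s) ⊍ (Y / t)} τ (G /ᴳ r) ↾₂) ((G ↾₂) /ᴳ t) e₂)))))
                  (⌜⌝-cong (G ∣ᴳ r) ((G ↾₁) ∣ᴳ s ⊍ᴳ (G ↾₂) ∣ᴳ t) e′)))
                (≈-sym (rel (⊗-cong ≈-refl (μ-⌜⌝ X Y ((G ↾₁) ∣ᴳ s) ((G ↾₂) ∣ᴳ t)))))))
            (≈-sym (⟦⟧-cong id⊗μ (⟦⟧-cong (δ {X} s ⊗₁ δ {Y} t) (Δ-⌜⌝ X Y G))))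

        isCompatible : IsCompatible B δ
        isCompatible = record
          { δ-μ   = λ {X} {Y} s split → ⌜⌝⊗-ext λ G H →
              δ-μ-⌜⌝ {X} {Y} s (_∣₁ {X} {Y} s) (_∣₂ {X} {Y} s) (/-⊍ {X} {Y} s split) G H
                (𝓔c-⊍ᴳ⁺ {X} {Y} G H s split) (𝓔c-⊍ᴳ⁻ {X} {Y} G H s split) (⊍ᴳ-/ᴳ G H s split) (⊍ᴳ-∣ᴳ G H s split)
          ; δ-μ-0 = λ {X} {Y} s ¬split → ⌜⌝⊗-ext λ G H →
              ≈-trans (⟦⟧-cong (δ {X ⊍ Y} s) (μ-⌜⌝ X Y G H))
                (δ-disconnected {X ⊍ Y} s (G ⊍ᴳ H) λ c → ¬split (𝓔c-⊍ᴳ⇒Splits {X} {Y} G H s c))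
          ; δ-Δ   = λ {X} {Y} s split → ⌜⌝-ext λ G →
              δ-Δ-⌜⌝ {X} {Y} s (_∣₁ {X} {Y} s) (_∣₂ {X} {Y} s) (/-⊍ {X} {Y} s split) G
                (𝓔c-split⁺ s split G) (𝓔c-split⁻ s split G)
                (/ᴳ-↾ι₁ s split G) (/ᴳ-↾ι₂ s split G) (∣ᴳ-split s split G)
          ; δ-𝟏   = ≈-trans (⟦⟧-cong ((act {∅ / discrete ∅} {∅} ∅/discrete ⊗₁ idₗ) ∘ₗ δ (discrete ∅)) 𝟏-⌜⌝)
              (≈-trans
                (δ-elim (P [ ∅ ] ⊗ P [ ∅ ]) (discrete ∅) emptyGraph (act {∅ / discrete ∅} {∅} ∅/discrete ⊗₁ idₗ)
                  (λ _ → rel (⊗-cong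
                    -- All graphs on `∅` are equal, as there is no vertex at which to compare
                    -- adjacency.
                    (act-⌜⌝-≈ {∅ / discrete ∅} {∅} ∅/discrete (emptyGraph /ᴳ discrete ∅) emptyGraph ((λ { {()} }) , (λ { {()} })))
                    (⌜⌝-cong (emptyGraph ∣ᴳ discrete ∅) emptyGraph ((λ { {()} }) , (λ { {()} })))))
                  (λ ¬c → contradiction (discrete-𝓔c emptyGraph) ¬c))
                (≈-sym (rel (⊗-cong 𝟏-⌜⌝ 𝟏-⌜⌝))))
          ; δ-ε   = λ x → at (⌜⌝-ext
              {f = unitˡ⊗ ∘ₗ ((ε ∘ₗ act {∅ / discrete ∅} {∅} ∅/discrete) ⊗₁ idₗ) ∘ₗ δ (discrete ∅)}
              -- The map sending `x` to ε(x)𝟏, written as a composite of linear maps so that it can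
              -- be tested on graphs.
              {unitʳ⊗ ∘ₗ tensorˡ 𝟏 ∘ₗ ε} λ G →
                δ-elim (P [ ∅ ]) (discrete ∅) G (unitˡ⊗ ∘ₗ ((ε ∘ₗ act {∅ / discrete ∅} {∅} ∅/discrete) ⊗₁ idₗ))
                  (λ _ → *ₗ-cong
                    (𝕂.trans (⟦⟧-cong ε (act-⌜⌝ {∅ / discrete ∅} {∅} ∅/discrete (G /ᴳ discrete ∅)))
                      (𝕂.trans (ε-⌜⌝ _) (𝕂.sym (ε-⌜⌝ G))))
                    (≈ᴹ-trans (⌜⌝-cong (G ∣ᴳ discrete ∅) emptyGraph ((λ { {()} }) , (λ { {()} }))) (≈ᴹ-sym 𝟏-⌜⌝)))
                  (λ ¬c → contradiction (discrete-𝓔c G) ¬c)) x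
          }
          where open LeftModule (P [ ∅ ])

  -- The species of graphs: its counit and the values of `δ`

  private
    𝟙 : Bool → 𝕂.Carrier
    𝟙 b = if b then 𝕂.1# else 𝕂.0#

  ϵ-edgeless : ∀ X → Free (𝓖 X) ⊸ 𝕂ᴹ
  ϵ-edgeless X = extendFree (𝓖 X) {N = 𝕂ᴹ} (λ G → 𝟙 (does (edgeless? G))) λ {G} {H} (G⇒H , H⇒G) →
    𝕂.reflexive (cong 𝟙 (does-⇔
      (mk⇔ (λ e x y a → e x y (H⇒G a)) (λ e x y a → e x y (G⇒H a))) (edgeless? G) (edgeless? H)))

  ϵ-edgeless-1 : (G : Graph X) → Edgeless G → ⟦ ϵ-edgeless X ⟧ (graph G) 𝕂.≈ 𝕂.1#
  ϵ-edgeless-1 G e = 𝕂.reflexive (cong 𝟙 (dec-true (edgeless? G) e))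

  ϵ-edgeless-0 : (G : Graph X) → ¬ Edgeless G → ⟦ ϵ-edgeless X ⟧ (graph G) 𝕂.≈ 𝕂.0#
  ϵ-edgeless-0 G ¬e = 𝕂.reflexive (cong 𝟙 (dec-false (edgeless? G) ¬e))

  module _ (s : 𝓔 X) (G : Graph X) where
    open LeftModule (𝐆 [ X / s ] ⊗ 𝐆 [ X ]) using (_≈ᴹ_)

    private
      -- Matching on the equation identifies `b` with the boolean tested in `δ`, so `δ` is evaluated
      -- without unfolding the decision procedure.
      δ-value : ∀ {b} → does (∈𝓔c? s G) ≡ b → ⟦ δ s ⟧ (graph G) ≈ᴹ (if b then (G /ᴳ s) ⊗ᴳ (G ∣ᴳ s) else 𝟘)
      δ-value ≡.refl = ≈-refl

    δ-graph-connected : s ∈𝓔c G → ⟦ δ s ⟧ (graph G) ≈ᴹ (G /ᴳ s) ⊗ᴳ (G ∣ᴳ s)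
    δ-graph-connected c = δ-value (dec-true (∈𝓔c? s G) c)

    δ-graph-disconnected : ¬ s ∈𝓔c G → ⟦ δ s ⟧ (graph G) ≈ᴹ 𝟘
    δ-graph-disconnected ¬c = δ-value (dec-false (∈𝓔c? s G) ¬c)

proposition2p7 : ∀ {c ℓ₁ ℓ₂} (K : HeytingField c ℓ₁ ℓ₂) → let open OverField K in
    IsContractionExtraction 𝐆 δ × IsCompatible 𝐆-bialgebra δ
proposition2p7 K =
    isContractionExtraction (ϵ-edgeless K) (ϵ-edgeless-1 K) (ϵ-edgeless-0 K)
  -- Maps extended from a basis compute on generators, so the required values hold by reflexivity.
  , isCompatible 𝐆-bialgebra (λ _ _ _ _ → ≈-refl) (λ _ _ _ → ≈-refl) ≈-refl (λ _ → CommutativeRing.refl 𝕂)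
  where
  open OverField K
  open SpannedByGraphs K 𝐆 graph (λ G H → graph-cong {G = G} {H}) (λ {_} {_} {X} → gen-ext (BasisRel (𝓖 X)))
    (λ _ _ → ≈-refl) δ (δ-graph-connected K) (δ-graph-disconnected K)
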